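{- Let $r\ge 0$ and let $\pi_1,\dots,\pi_r,\pi'_1,\dots,\pi'_r$ be permutations such that, for every $i\in\{1,\dots,r\}$, the sets $\{312,\pi_i\}$ and $\{312,\pi'_i\}$ are $\mathrm{inv}$-Wilf equivalent. Set $\pi=\iota_r[\pi_{1*},\dots,\pi_{r*}]$ and $\pi'=\iota_r[\pi'_{1*},\dots,\pi'_{r*}]$. Then $\{312,\pi\}$ and $\{312,\pi'\}$ are $\mathrm{inv}$-Wilf equivalent, i.e. $F^{\mathrm{inv}}_n(\{312,\pi\};q)=F^{\mathrm{inv}}_n(\{312,\pi'\};q)$ for all $n\ge 0$.
   Context: $\mathfrak{S}_n$ is the set of permutations of $\{1,\dots,n\}$ in one-line notation, $\mathfrak{S}=\bigcup_{n\ge 0}\mathfrak{S}_n$, and $\mathfrak{S}_0=\{\epsilon\}$ with $\epsilon$ the empty permutation. A permutation $\sigma$ contains $\pi$ if some subsequence of $\sigma$ has the same relative order as $\pi$ (so every permutation contains $\epsilon$); otherwise $\sigma$ avoids $\pi$. For $\Pi\subseteq\mathfrak{S}$, $\mathfrak{S}_n(\Pi)$ is the set of $\sigma\in\mathfrak{S}_n$ avoiding every pattern in $\Pi$. The inversion number of $\sigma\in\mathfrak{S}_n$ is $\mathrm{inv}(\sigma)=\#\{(i,j): 1\le i<j\le n,\ \sigma(i)>\sigma(j)\}$, and $F^{\mathrm{inv}}_n(\Pi;q)=\sum_{\sigma\in\mathfrak{S}_n(\Pi)}q^{\mathrm{inv}(\sigma)}$. Two sets $\Pi,\Pi'$ are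 $\mathrm{inv}$-Wilf equivalent if $F^{\mathrm{inv}}_n(\Pi;q)=F^{\mathrm{inv}}_n(\Pi';q)$ for all $n\ge 0$. For $\tau\in\mathfrak{S}_k$ and $\sigma_1,\dots,\sigma_k\in\mathfrak{S}$, the inflation $\tau[\sigma_1,\dots,\sigma_k]$ is the permutation that is a concatenation of $k$ consecutive blocks of positions, the $i$-th block (of length $|\sigma_i|$) having the relative order of $\sigma_i$ and occupying an interval of values, with the blocks' value intervals arranged relative to one another in the order of $\tau$ (all values in block $i$ are less than all values in block $j$ iff $\tau(i)<\tau(j)$); e.g. $213[123,1,21]=234165$. $\iota_r=12\cdots r$ is the identity of $\mathfrak{S}_r$ (and $\iota_0[\,]=\epsilon$), so $\iota_r[\sigma_1,\dots,\sigma_r]$ is the direct sum of the $\sigma_i$. For a permutation $\pi\in\mathfrak{S}_m$, $\pi_*:=21[\pi,1]\in\mathfrak{S}_{m+1}$, i.e. $\pi_*=(\pi(1)+1)\cdots(\pi(m)+1)\,1$; and $\pi_{i*}$ means $(\pi_i)_*$. -}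

module Defs where

open import Data.Bool.Base using (if_then_else_)
open import Data.Fin.Base
  using (Fin; zero; suc; _<_; toℕ; punchIn; punchOut; finToFun; funToFin)
open import Data.Fin.Patterns using (0F; 1F; 2F)
open import Data.Fin.Permutation
  using (Permutation′; _⟨$⟩ʳ_; _≈_; _∘ₚ_; flip; cast-id; insert; remove; inverseˡ)
  renaming (id to idₚ)
open import Data.Fin.Properties
  using (_<?_; any?; all?; finToFun-funToFin; +↔⊎; punchIn-injective; punchIn-punchOut)
open import Data.List.Base
  using (List; []; _∷_; map; concatMap; filter; foldr; length; allFin; cartesianProduct; tabulate; lookup)
open import Data.List.Membership.Propositional.Properties using (∈-allFin)
open import Data.List.Relation.Unary.All as All using (All)
import Data.List.Relation.Unary.All.Properties as All
open import Data.List.Relation.Unary.AllPairs as AllPairs using (AllPairs; []; _∷_)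
import Data.List.Relation.Unary.AllPairs.Properties as AllPairs
open import Data.List.Relation.Unary.Any as Any using (Any; here)
import Data.List.Relation.Unary.Any.Properties as Any
open import Data.List.Relation.Unary.Unique.Propositional.Properties using (allFin⁺)
open import Data.Nat.Base using (ℕ; zero; suc; _+_; _^_)
open import Data.Nat.Properties using (_≟_; +-0-commutativeMonoid)
open import Algebra.Properties.CommutativeMonoid.Sum +-0-commutativeMonoid
  using (sum; sum-permute)
open import Data.Product.Base using (Σ; ∃; _×_; _,_; proj₁; proj₂)
open import Data.Product.Function.Dependent.Propositional using (Σ-↔)
open import Data.Sum.Base using (_⊎_; inj₁; inj₂)
open import Data.Sum.Function.Propositional using (_⊎-↔_)
open import Data.Vec.Functional using (Vector; tail)
open import Function.Base using (_∘_)
open import Function.Bundles using (_↔_; _⇔_; mk↔ₛ′; mk⇔; Equivalence; Inverse)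
open import Function.Construct.Composition using (_↔-∘_)
open import Function.Construct.Identity using (↔-id)
open import Function.Construct.Symmetry using (↔-sym)
open import Relation.Binary.PropositionalEquality
  using (_≡_; _≗_; refl; sym; trans; cong; subst₂)
open import Relation.Nullary using (¬_; Dec; does)
open import Relation.Nullary.Decidable using (map′; ¬?; _×-dec_; _→-dec_)

private
  variable
    k m n : ℕ

-- Positions and values are 0-based: a permutation of {1,…,n} is a
-- bijection of Fin n = {0,…,n-1}, and σ ⟨$⟩ʳ i is its letter at position i.

𝔖 : Set
𝔖 = Σ ℕ Permutation′

∣_∣ : 𝔖 → ℕ
∣_∣ = proj₁

-- The 1-based one-line notation, used only in the examples below.
oneLine : 𝔖 → List ℕ
oneLine (n , σ) = tabulate (λ i → suc (toℕ (σ ⟨$⟩ʳ i)))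

ι : ∀ r → Permutation′ r
ι r = idₚ

-- insert 0F j σ has first letter j, followed by σ order-isomorphically
-- relabelled by the remaining values.
p21 : Permutation′ 2
p21 = insert 0F 1F (ι 1)

p312 : 𝔖
p312 = 3 , insert 0F 2F (ι 2)

_ : oneLine (_ , p21) ≡ 2 ∷ 1 ∷ []
_ = refl

_ : oneLine p312 ≡ 3 ∷ 1 ∷ 2 ∷ []
_ = refl

IsOccurrence : Permutation′ n → Permutation′ m → (Fin m → Fin n) → Set
IsOccurrence σ π e =
  (∀ i j → i < j → e i < e j) ×
  (∀ i j → (π ⟨$⟩ʳ i < π ⟨$⟩ʳ j) ⇔ (σ ⟨$⟩ʳ e i < σ ⟨$⟩ʳ e j))

Contains : Permutation′ n → 𝔖 → Set
Contains σ (m , π) = ∃ (IsOccurrence σ π)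

AvoidsAll : List 𝔖 → Permutation′ n → Set
AvoidsAll Π σ = All (λ π → ¬ Contains σ π) Π

isOccurrence? : (σ : Permutation′ n) (π : Permutation′ m) →
                ∀ e → Dec (IsOccurrence σ π e)
isOccurrence? σ π e =
  all? (λ i → all? λ j → i <? j →-dec e i <? e j) ×-dec
  all? (λ i → all? λ j →
    let P? = π ⟨$⟩ʳ i <? π ⟨$⟩ʳ j
        Q? = σ ⟨$⟩ʳ e i <? σ ⟨$⟩ʳ e j
    in map′ (λ (f , g) → mk⇔ f g)
            (λ eq → Equivalence.to eq , Equivalence.from eq)
            ((P? →-dec Q?) ×-dec (Q? →-dec P?)))

isOccurrence-resp : (σ : Permutation′ n) (π : Permutation′ m) {e f : Fin m → Fin n} →
                    e ≗ f → IsOccurrence σ π e → IsOccurrence σ π f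
isOccurrence-resp σ π e≗f (mono , iso) =
  (λ i j i<j → subst₂ _<_ (e≗f i) (e≗f j) (mono i j i<j)) ,
  (λ i j → subst₂ (λ x y → (π ⟨$⟩ʳ i < π ⟨$⟩ʳ j) ⇔ (σ ⟨$⟩ʳ x < σ ⟨$⟩ʳ y))
                  (e≗f i) (e≗f j) (iso i j))

contains? : (σ : Permutation′ n) (π : 𝔖) → Dec (Contains σ π)
contains? {n} σ (m , π) = map′
  (λ (c , occ) → finToFun c , occ)
  (λ (e , occ) → funToFin e ,
     isOccurrence-resp σ π (λ i → sym (finToFun-funToFin e i)) occ)
  (any? {n = n ^ m} λ c → isOccurrence? σ π (finToFun c))

avoidsAll? : (Π : List 𝔖) (σ : Permutation′ n) → Dec (AvoidsAll Π σ)
avoidsAll? Π σ = All.all? (λ π → ¬? (contains? σ π)) Π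

-- 𝔖ₙ in lexicographic order of one-line notation.
permutations : ∀ n → List (Permutation′ n)
permutations zero    = idₚ ∷ []
permutations (suc n) =
  concatMap (λ j → map (insert 0F j) (permutations n)) (allFin (suc n))

-- Every permutation occurs exactly once, up to pointwise equality.

permutations-complete : (σ : Permutation′ n) → Any (σ ≈_) (permutations n)
permutations-complete {zero}  σ = here λ ()
permutations-complete {suc n} σ = Any.concatMap⁺ _ (Any.map at-first (∈-allFin (σ ⟨$⟩ʳ 0F)))
  where
  rebuild : ∀ {τ} → remove 0F σ ≈ τ → σ ≈ insert 0F (σ ⟨$⟩ʳ 0F) τ
  rebuild eq zero    = refl
  rebuild eq (suc i) =
    trans (sym (punchIn-punchOut _)) (cong (punchIn (σ ⟨$⟩ʳ 0F)) (eq i))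

  at-first : ∀ {j} → σ ⟨$⟩ʳ 0F ≡ j → Any (σ ≈_) (map (insert 0F j) (permutations n))
  at-first refl = Any.map⁺ (Any.map rebuild (permutations-complete (remove 0F σ)))

permutations-unique : ∀ n → AllPairs (λ σ τ → ¬ (σ ≈ τ)) (permutations n)
permutations-unique zero    = All.[] ∷ []
permutations-unique (suc n) = AllPairs.concat⁺
  (All.map⁺ (All.tabulate λ {j} _ → AllPairs.map⁺ (AllPairs.map
    (λ σ≉τ eq → σ≉τ (λ i → punchIn-injective j _ _ (eq (suc i))))
    (permutations-unique n))))
  (AllPairs.map⁺ (AllPairs.map
    (λ j≢j′ → All.map⁺ (All.tabulate λ _ → All.map⁺ (All.tabulate λ _ eq → j≢j′ (eq zero))))
    (allFin⁺ (suc n))))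

inv : Permutation′ n → ℕ
inv {n} σ = length (filter (λ (i , j) → i <? j ×-dec σ ⟨$⟩ʳ j <? σ ⟨$⟩ʳ i)
                           (cartesianProduct (allFin n) (allFin n)))

-- A polynomial in q over ℕ is given by its sequence of coefficients;
-- equality of polynomials is _≗_.
Polynomial : Set
Polynomial = ℕ → ℕ

0ₚ : Polynomial
0ₚ _ = 0

_+ₚ_ : Polynomial → Polynomial → Polynomial
(f +ₚ g) d = f d + g d

q^_ : ℕ → Polynomial
(q^ a) d = if does (a ≟ d) then 1 else 0

-- Pattern sets are finite, so that avoidance is decidable.
F : ∀ n → List 𝔖 → Polynomial
F n Π = foldr _+ₚ_ 0ₚ (map (λ σ → q^ inv σ) (filter (avoidsAll? Π) (permutations n)))

InvWilfEquivalent : List 𝔖 → List 𝔖 → Set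
InvWilfEquivalent Π Π′ = ∀ n → F n Π ≗ F n Π′

-- The lexicographic splitting of k consecutive intervals of lengths
-- ls 0, …, ls (k-1): (i , a) is the a-th point of the i-th interval.
blocks : (ls : Vector ℕ k) → Fin (sum ls) ↔ Σ (Fin k) (λ i → Fin (ls i))
blocks {zero}  ls = mk↔ₛ′ (λ ()) (λ ()) (λ ()) (λ ())
blocks {suc k} ls = cons ↔-∘ ((↔-id _ ⊎-↔ blocks (tail ls)) ↔-∘ +↔⊎)
  where
  cons : (Fin (ls zero) ⊎ Σ (Fin k) (λ i → Fin (ls (suc i)))) ↔
         Σ (Fin (suc k)) (λ i → Fin (ls i))
  cons = mk↔ₛ′
    (λ { (inj₁ a) → zero , a ; (inj₂ (i , a)) → suc i , a })
    (λ { (zero , a) → inj₁ a ; (suc i , a) → inj₂ (i , a) })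
    (λ { (zero , a) → refl ; (suc i , a) → refl })
    (λ { (inj₁ a) → refl ; (inj₂ (i , a)) → refl })

-- τ [ σ ] is the inflation of τ.  Positions are split into blocks of
-- lengths |σ₀|, |σ₁|, …; values are split, from the smallest up, into
-- intervals the j-th of which has length |σ_{τ⁻¹(j)}|.  Position a of
-- block i receives value σᵢ(a) of interval τ(i).
_[_] : Permutation′ k → (Fin k → 𝔖) → 𝔖
_[_] {k} τ σ =
  sum ls ,
  blocks ls ∘ₚ′ Σ-↔ τ (λ {i} → proj₂ (σ i) ∘ₚ cast-id (cong ls (sym (inverseˡ τ))))
            ∘ₚ′ ↔-sym (blocks ls′)
            ∘ₚ′ cast-id (sym (sum-permute ls (flip τ)))
  where
  ls ls′ : Vector ℕ k
  ls i  = ∣ σ i ∣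
  ls′ j = ls (Inverse.from τ j)

  infixr 9 _∘ₚ′_
  _∘ₚ′_ : {A B C : Set} → A ↔ B → B ↔ C → A ↔ C
  f ∘ₚ′ g = g ↔-∘ f

_ : oneLine (insert 0F 1F (ι 2) [ lookup ((3 , ι 3) ∷ (1 , ι 1) ∷ (2 , p21) ∷ []) ]) ≡
    2 ∷ 3 ∷ 4 ∷ 1 ∷ 6 ∷ 5 ∷ []
_ = refl

_* : 𝔖 → 𝔖
π * = p21 [ lookup (π ∷ (1 , ι 1) ∷ []) ]

{-# OPTIONS --safe #-}

-- A 312-avoiding permutation splits at its least letter as σ = L⋆ ⊕ R with L⋆ = 21[L,1], and
-- inv σ = inv L + |L| + inv R; so these permutations are binary trees.  A summand πᵢ⋆ of the
-- pattern is ⊕-indecomposable, hence an occurrence of π₁⋆ ⊕ … ⊕ πⱼ⋆ in σ matches an initial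
-- run of summands in L⋆ and the others in R.  Let h σ be the greatest j such that
-- π₁⋆ ⊕ … ⊕ πⱼ⋆ occurs in σ.  By induction on n, the joint distribution of (h, inv) on the
-- 312-avoiders of size n is the same for π and π′: h σ is found greedily, first in L⋆, then
-- in R with the remaining patterns, and the greatest j for L⋆ is max(1, h L) if π₁ occurs
-- in L and 0 otherwise, which is governed by the distribution of (h, inv) on all L together
-- with that of inv on the L avoiding π₁.

module Submission where

open import Defs
open import Algebra.Properties.CommutativeSemigroup using (interchange)
open import Data.Bool.Base using (true; false; if_then_else_)
open import Data.Empty using (⊥; ⊥-elim)
open import Data.Fin.Base as Fin using (Fin; zero; suc; toℕ; fromℕ<; cast)
open import Data.Fin.Patterns using (0F; 1F; 2F)
open import Data.Fin.Permutation using (Permutation′; _⟨$⟩ʳ_; permutation)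
import Data.Fin.Properties as Fin
open import Data.List.Base
  using (List; []; _∷_; _++_; map; concatMap; filter; foldr; take; drop; length; lookup;
         tabulate; allFin; cartesianProduct; cartesianProductWith)
open import Data.List.Extrema.Nat using (max; ⊥≤max; xs≤max; argmax-sel)
open import Data.List.Membership.Propositional using (_∈_; _∉_; find; lose)
open import Data.List.Membership.Propositional.Properties
  using (∈-++⁺ˡ; ∈-++⁺ʳ; ∈-++⁻; ∈-∃++; ∈-lookup; ∈-map⁺; ∈-map⁻; ∈-tabulate⁺; ∈-tabulate⁻;
         ∈-filter⁺; ∈-filter⁻; ∈-concatMap⁺; ∈-concatMap⁻;
         ∈-cartesianProductWith⁺; ∈-cartesianProductWith⁻)
open import Data.List.Membership.Propositional.Properties.WithK using (unique∧set⇒bag)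
import Data.List.Properties as List
open import Data.List.Relation.Binary.BagAndSetEquality using (∼bag⇒↭)
open import Data.List.Relation.Binary.Permutation.Propositional using (_↭_)
import Data.List.Relation.Binary.Permutation.Propositional.Properties as ↭
open import Data.List.Relation.Binary.Pointwise as Pointwise using (Pointwise; []; _∷_)
open import Data.List.Relation.Unary.All as All using (All; []; _∷_)
import Data.List.Relation.Unary.All.Properties as All
open import Data.List.Relation.Unary.AllPairs as AllPairs using (AllPairs; []; _∷_)
import Data.List.Relation.Unary.AllPairs.Properties as AllPairs
open import Data.List.Relation.Unary.Any using (here; there; index)
open import Data.List.Relation.Unary.Any.Properties using (lookup-index)
open import Data.List.Relation.Unary.Unique.Propositional using (Unique)
import Data.List.Relation.Unary.Unique.Propositional.Properties as Unique
open import Data.Nat.Base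
  using (ℕ; zero; suc; _+_; _∸_; _⊔_; _<_; _≤_; z≤n; s≤s; z<s; s<s; s≤s⁻¹)
open import Data.Nat.ListAction using (sum)
open import Data.Nat.ListAction.Properties using (sum-++; sum-↭)
import Data.Nat.Properties as ℕ
open import Data.Nat.Solver using (module +-*-Solver)
open import Data.Product.Base using (Σ; ∃; ∃₂; _×_; _,_; proj₁; proj₂; map₁; uncurry)
open import Data.Sum.Base as Sum using (_⊎_; inj₁; inj₂; [_,_]′)
open import Data.Unit.Base using (⊤; tt)
open import Data.Vec.Functional using (Vector)
open import Function.Base using (_∘_; id; _$_)
open import Function.Bundles using (_⇔_; mk⇔; Equivalence; Injection; Inverse)
open import Function.Properties.Inverse using (↔⇒↣)
open import Relation.Binary.Definitions using (tri<; tri≈; tri>)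
open import Relation.Binary.PropositionalEquality hiding ([_])
open import Relation.Nullary using (¬_; Dec; yes; no; does; contradiction)
open import Relation.Nullary.Decidable using (¬?; _×-dec_; map′; dec-true; dec-false; does-⇔)

-- The hypothesis controls `inv` on the trees avoiding the head pattern, but says nothing about
-- `inv` jointly with `h`. It still suffices: a tree avoiding π₁ contains no π₁⋆, so `h` is 0 on it,
-- and the joint law for L⋆ arises from that of (max(1, h L), inv) by moving exactly the mass of
-- these trees from 1 to 0. The maximum with 1 is due to the extra letter of L⋆, which is last in
-- position and least in value: it can only be the last letter of a lone summand, and with two or
-- more summands none can use it. Passing to R replaces the patterns by a suffix of their list, so
-- the induction runs over all pairs of lists with equivalent entries. Inflation flattens its blocks
-- to a single `Fin`, with casts for positions and for values. Containment is therefore moved to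
-- sets with two relations, where `⊕` and `⋆` are plain disjoint sums, and permutations meet trees
-- through words on intervals of naturals.

private variable
  A B C : Set

-- Sets with two relations, and containment as embedding

-- <₁ compares positions and <₂ values; σ contains π iff ⟦ π ⟧ ⊑ ⟦ σ ⟧.
record Biorder : Set₁ where
  field
    Carrier : Set
    _<₁_ _<₂_ : Carrier → Carrier → Set

open Biorder using (Carrier)

infix 4 _⊑_ _≋_

record _⊑_ (A B : Biorder) : Set where
  private
    module A = Biorder A
    module B = Biorder B
  field
    fun   : A.Carrier → B.Carrier
    mono₁ : ∀ x y → x A.<₁ y → fun x B.<₁ fun y
    mono₂ : ∀ x y → x A.<₂ y → fun x B.<₂ fun y
    refl₂ : ∀ x y → fun x B.<₂ fun y → x A.<₂ y

open _⊑_

⊑-refl : ∀ {A} → A ⊑ A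
⊑-refl = record { fun = id ; mono₁ = λ _ _ → id ; mono₂ = λ _ _ → id ; refl₂ = λ _ _ → id }

⊑-trans : ∀ {A B C} → A ⊑ B → B ⊑ C → A ⊑ C
⊑-trans f g = record
  { fun   = fun g ∘ fun f
  ; mono₁ = λ x y → mono₁ g _ _ ∘ mono₁ f x y
  ; mono₂ = λ x y → mono₂ g _ _ ∘ mono₂ f x y
  ; refl₂ = λ x y → refl₂ f x y ∘ refl₂ g _ _
  }

-- Mutual embedding rather than isomorphism: this is what it takes to exchange either side of a
-- statement `A ⊑ B`.
_≋_ : Biorder → Biorder → Set
A ≋ B = A ⊑ B × B ⊑ A

-- For mutually inverse maps, reflection of values in one direction is monotonicity in the other.
mk≋ : ∀ {A B} (f : Carrier A → Carrier B) (g : Carrier B → Carrier A) →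
      (∀ x → g (f x) ≡ x) → (∀ y → f (g y) ≡ y) →
      let module A = Biorder A; module B = Biorder B in
      (∀ x y → x A.<₁ y → f x B.<₁ f y) → (∀ x y → x A.<₂ y → f x B.<₂ f y) →
      (∀ x y → x B.<₁ y → g x A.<₁ g y) → (∀ x y → x B.<₂ y → g x A.<₂ g y) →
      A ≋ B
mk≋ {A} {B} f g gf fg f₁ f₂ g₁ g₂ =
  record { fun = f ; mono₁ = f₁ ; mono₂ = f₂
         ; refl₂ = λ x y lt → subst₂ (Biorder._<₂_ A) (gf x) (gf y) (g₂ _ _ lt) } ,
  record { fun = g ; mono₁ = g₁ ; mono₂ = g₂
         ; refl₂ = λ x y lt → subst₂ (Biorder._<₂_ B) (fg x) (fg y) (f₂ _ _ lt) }

≋-trans : ∀ {A B C} → A ≋ B → B ≋ C → A ≋ C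
≋-trans (f , f′) (g , g′) = ⊑-trans f g , ⊑-trans g′ f′

⟦_⟧ : 𝔖 → Biorder
⟦ n , σ ⟧ = record
  { Carrier = Fin n
  ; _<₁_    = Fin._<_
  ; _<₂_    = λ i j → σ ⟨$⟩ʳ i Fin.< σ ⟨$⟩ʳ j
  }

contains⇒⊑ : ∀ {n} (σ : Permutation′ n) p → Contains σ p → ⟦ p ⟧ ⊑ ⟦ n , σ ⟧
contains⇒⊑ σ p (e , mono , iso) = record
  { fun   = e
  ; mono₁ = mono
  ; mono₂ = λ i j → Equivalence.to (iso i j)
  ; refl₂ = λ i j → Equivalence.from (iso i j)
  }

⊑⇒contains : ∀ {n} (σ : Permutation′ n) p → ⟦ p ⟧ ⊑ ⟦ n , σ ⟧ → Contains σ p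
⊑⇒contains σ p f = fun f , mono₁ f , (λ i j → mk⇔ (mono₂ f i j) (refl₂ f i j))

-- Direct sums and the operation 21[A,1]

𝟘 : Biorder
𝟘 = record { Carrier = ⊥ ; _<₁_ = λ () ; _<₂_ = λ () }

infixr 6 _⊕_
infix 8 _⋆

_⊕_ : Biorder → Biorder → Biorder
A ⊕ B = record { Carrier = A.Carrier ⊎ B.Carrier ; _<₁_ = lt A._<₁_ B._<₁_ ; _<₂_ = lt A._<₂_ B._<₂_ }
  where
  module A = Biorder A
  module B = Biorder B
  lt : (A.Carrier → A.Carrier → Set) → (B.Carrier → B.Carrier → Set) →
       A.Carrier ⊎ B.Carrier → A.Carrier ⊎ B.Carrier → Set
  lt R S (inj₁ x) (inj₁ y) = R x y
  lt R S (inj₁ x) (inj₂ y) = ⊤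
  lt R S (inj₂ x) (inj₁ y) = ⊥
  lt R S (inj₂ x) (inj₂ y) = S x y

_⋆ : Biorder → Biorder
A ⋆ = record { Carrier = A.Carrier ⊎ ⊤ ; _<₁_ = lt₁ ; _<₂_ = lt₂ }
  where
  module A = Biorder A
  lt₁ lt₂ : A.Carrier ⊎ ⊤ → A.Carrier ⊎ ⊤ → Set
  lt₁ (inj₁ x) (inj₁ y) = x A.<₁ y
  lt₁ (inj₁ x) (inj₂ _) = ⊤
  lt₁ (inj₂ _) _        = ⊥
  lt₂ (inj₁ x) (inj₁ y) = x A.<₂ y
  lt₂ (inj₁ x) (inj₂ _) = ⊥
  lt₂ (inj₂ _) (inj₁ y) = ⊤
  lt₂ (inj₂ _) (inj₂ _) = ⊥

⊕-mono : ∀ {A A′ B B′} → A ⊑ A′ → B ⊑ B′ → A ⊕ B ⊑ A′ ⊕ B′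
⊕-mono {A} {A′} {B} {B′} f g = record { fun = h ; mono₁ = m₁ ; mono₂ = m₂ ; refl₂ = r₂ }
  where
  module S = Biorder (A ⊕ B)
  module T = Biorder (A′ ⊕ B′)
  h : S.Carrier → T.Carrier
  h (inj₁ x) = inj₁ (fun f x)
  h (inj₂ y) = inj₂ (fun g y)
  m₁ : ∀ x y → x S.<₁ y → h x T.<₁ h y
  m₁ (inj₁ x) (inj₁ y) = mono₁ f x y
  m₁ (inj₁ x) (inj₂ y) = id
  m₁ (inj₂ x) (inj₂ y) = mono₁ g x y
  m₂ : ∀ x y → x S.<₂ y → h x T.<₂ h y
  m₂ (inj₁ x) (inj₁ y) = mono₂ f x y
  m₂ (inj₁ x) (inj₂ y) = id
  m₂ (inj₂ x) (inj₂ y) = mono₂ g x y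
  r₂ : ∀ x y → h x T.<₂ h y → x S.<₂ y
  r₂ (inj₁ x) (inj₁ y) = refl₂ f x y
  r₂ (inj₁ x) (inj₂ y) = id
  r₂ (inj₂ x) (inj₂ y) = refl₂ g x y

⋆-mono : ∀ {A A′} → A ⊑ A′ → A ⋆ ⊑ A′ ⋆
⋆-mono {A} {A′} f = record { fun = h ; mono₁ = m₁ ; mono₂ = m₂ ; refl₂ = r₂ }
  where
  module S = Biorder (A ⋆)
  module T = Biorder (A′ ⋆)
  h : S.Carrier → T.Carrier
  h (inj₁ x) = inj₁ (fun f x)
  h (inj₂ y) = inj₂ y
  m₁ : ∀ x y → x S.<₁ y → h x T.<₁ h y
  m₁ (inj₁ x) (inj₁ y) = mono₁ f x y
  m₁ (inj₁ x) (inj₂ y) = id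
  m₂ : ∀ x y → x S.<₂ y → h x T.<₂ h y
  m₂ (inj₁ x) (inj₁ y) = mono₂ f x y
  m₂ (inj₂ x) (inj₁ y) = id
  r₂ : ∀ x y → h x T.<₂ h y → x S.<₂ y
  r₂ (inj₁ x) (inj₁ y) = refl₂ f x y
  r₂ (inj₂ x) (inj₁ y) = id

⊕-cong : ∀ {A A′ B B′} → A ≋ A′ → B ≋ B′ → A ⊕ B ≋ A′ ⊕ B′
⊕-cong (f , f′) (g , g′) = ⊕-mono f g , ⊕-mono f′ g′

⋆-cong : ∀ {A A′} → A ≋ A′ → A ⋆ ≋ A′ ⋆
⋆-cong (f , f′) = ⋆-mono f , ⋆-mono f′

-- Inflations as lexicographic orders

module _ {k} (ls : Vector ℕ k) where

  private Block = Σ (Fin k) (Fin ∘ ls)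

  Lex : Block → Block → Set
  Lex (i , a) (j , b) = i Fin.< j ⊎ (i ≡ j × toℕ a < toℕ b)

  Lex-connex : ∀ u v → u ≢ v → Lex u v ⊎ Lex v u
  Lex-connex (i , a) (j , b) u≢v with Fin.<-cmp i j
  ... | tri< i<j _ _ = inj₁ (inj₁ i<j)
  ... | tri> _ _ j<i = inj₂ (inj₁ j<i)
  ... | tri≈ _ refl _ with Fin.<-cmp a b
  ...   | tri< a<b _ _ = inj₁ (inj₂ (refl , a<b))
  ...   | tri≈ _ refl _ = contradiction refl u≢v
  ...   | tri> _ _ b<a = inj₂ (inj₂ (refl , b<a))

blocks⁻¹-mono : ∀ {k} (ls : Vector ℕ k) u v → Lex ls u v →
                Inverse.from (blocks ls) u Fin.< Inverse.from (blocks ls) v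
blocks⁻¹-mono {suc k} ls (zero , a) (zero , b) (inj₂ (_ , a<b)) =
  subst₂ _<_ (sym (Fin.toℕ-↑ˡ a _)) (sym (Fin.toℕ-↑ˡ b _)) a<b
blocks⁻¹-mono {suc k} ls (zero , a) (suc j , b) _ =
  subst₂ _<_ (sym (Fin.toℕ-↑ˡ a _)) (sym (Fin.toℕ-↑ʳ (ls zero) _))
    (ℕ.<-≤-trans (Fin.toℕ<n a) (ℕ.m≤m+n _ _))
blocks⁻¹-mono {suc k} ls (suc i , a) (zero , b) (inj₁ ())
blocks⁻¹-mono {suc k} ls (suc i , a) (zero , b) (inj₂ (() , _))
blocks⁻¹-mono {suc k} ls (suc i , a) (suc j , b) lex =
  subst₂ _<_ (sym (Fin.toℕ-↑ʳ (ls zero) _)) (sym (Fin.toℕ-↑ʳ (ls zero) _))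
    (ℕ.+-monoʳ-< (ls zero) (blocks⁻¹-mono (ls ∘ suc) (i , a) (j , b) (pred lex)))
  where
  pred : Lex ls (suc i , a) (suc j , b) → Lex (ls ∘ suc) (i , a) (j , b)
  pred (inj₁ (s≤s i<j))   = inj₁ i<j
  pred (inj₂ (refl , a<b)) = inj₂ (refl , a<b)

-- `Lex` is total on distinct points, so if the images stood in the opposite order, `blocks⁻¹-mono`
-- would carry this back to y < x.
blocks-mono : ∀ {k} (ls : Vector ℕ k) x y → x Fin.< y →
              Lex ls (Inverse.to (blocks ls) x) (Inverse.to (blocks ls) y)
blocks-mono ls x y x<y = case (Lex-connex ls (to x) (to y) λ eq → Fin.<⇒≢ x<y (to-inj eq))
  where
  open Inverse (blocks ls)
  to-inj : to x ≡ to y → x ≡ y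
  to-inj eq = trans (sym (inverseʳ refl)) (inverseʳ eq)
  case : Lex ls (to x) (to y) ⊎ Lex ls (to y) (to x) → Lex ls (to x) (to y)
  case (inj₁ lt) = lt
  case (inj₂ gt) = contradiction x<y (Fin.<-asym (subst₂ Fin._<_ (inverseʳ refl) (inverseʳ refl)
                     (blocks⁻¹-mono ls _ _ gt)))

-- The inflation before flattening: both relations live on pairs of a block and a point in it, so no
-- casts or interval lengths occur.
Inflation : ∀ {k} → Permutation′ k → (Fin k → 𝔖) → Biorder
Inflation {k} τ σ = record
  { Carrier = Σ (Fin k) (Fin ∘ ∣_∣ ∘ σ)
  ; _<₁_    = Lex (∣_∣ ∘ σ)
  ; _<₂_    = λ (i , a) (j , b) → (τ ⟨$⟩ʳ i Fin.< τ ⟨$⟩ʳ j) ⊎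
                (i ≡ j × toℕ (proj₂ (σ i) ⟨$⟩ʳ a) < toℕ (proj₂ (σ j) ⟨$⟩ʳ b))
  }

inflation-≋ : ∀ {k} (τ : Permutation′ k) (σ : Fin k → 𝔖) → ⟦ τ [ σ ] ⟧ ≋ Inflation τ σ
inflation-≋ {k} τ σ = mk≋ to from (λ _ → inverseʳ refl) (λ _ → inverseˡ refl)
  (blocks-mono ls) into₂ (blocks⁻¹-mono ls) outof₂
  where
  ls ls′ : Vector ℕ k
  ls i  = ∣ σ i ∣
  ls′ j = ls (Inverse.from τ j)
  open Inverse (blocks ls) using (to; from; inverseˡ; inverseʳ)
  module S = Biorder ⟦ τ [ σ ] ⟧
  module T = Biorder (Inflation τ σ)

  -- The value as a pair of value interval and offset: the composite that defines `_[_]`, stopped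
  -- before it flattens this pair to a number.
  value : T.Carrier → Σ (Fin k) (Fin ∘ ls′)
  value (i , a) = τ ⟨$⟩ʳ i , cast (cong ls (sym (Inverse.inverseʳ τ refl))) (proj₂ (σ i) ⟨$⟩ʳ a)

  toℕ-value : ∀ x → toℕ (proj₂ (τ [ σ ]) ⟨$⟩ʳ x) ≡ toℕ (Inverse.from (blocks ls′) (value (to x)))
  toℕ-value x = Fin.toℕ-cast _ _

  lt⇔lex : ∀ u v → (Inverse.from (blocks ls′) u Fin.< Inverse.from (blocks ls′) v) ⇔ Lex ls′ u v
  lt⇔lex u v = mk⇔
    (λ lt → subst₂ (Lex ls′) (Inverse.inverseˡ (blocks ls′) refl) (Inverse.inverseˡ (blocks ls′) refl)
              (blocks-mono ls′ _ _ lt))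
    (blocks⁻¹-mono ls′ u v)

  value⇒ : ∀ u v → Lex ls′ (value u) (value v) → u T.<₂ v
  value⇒ u v (inj₁ lt) = inj₁ lt
  value⇒ (i , a) (j , b) (inj₂ (eq , lt)) =
    inj₂ (trans (sym (Inverse.inverseʳ τ refl)) (Inverse.inverseʳ τ eq) ,
          subst₂ _<_ (Fin.toℕ-cast _ _) (Fin.toℕ-cast _ _) lt)

  value⇐ : ∀ u v → u T.<₂ v → Lex ls′ (value u) (value v)
  value⇐ u v (inj₁ lt) = inj₁ lt
  value⇐ (i , a) (j , b) (inj₂ (refl , lt)) =
    inj₂ (refl , subst₂ _<_ (sym (Fin.toℕ-cast _ _)) (sym (Fin.toℕ-cast _ _)) lt)

  into₂ : ∀ x y → x S.<₂ y → to x T.<₂ to y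
  into₂ x y lt = value⇒ (to x) (to y) (Equivalence.to (lt⇔lex _ _) (subst₂ _<_ (toℕ-value x) (toℕ-value y) lt))

  into₂⁻ : ∀ x y → to x T.<₂ to y → x S.<₂ y
  into₂⁻ x y lt = subst₂ _<_ (sym (toℕ-value x)) (sym (toℕ-value y)) (Equivalence.from (lt⇔lex _ _) (value⇐ _ _ lt))

  outof₂ : ∀ u v → u T.<₂ v → from u S.<₂ from v
  outof₂ u v lt = into₂⁻ _ _ (subst₂ T._<₂_ (sym (inverseˡ refl)) (sym (inverseˡ refl)) lt)

*-≋-⋆ : ∀ p → ⟦ p * ⟧ ≋ ⟦ p ⟧ ⋆
*-≋-⋆ p = ≋-trans (inflation-≋ p21 σ) (mk≋ f g gf fg f₁ f₂ g₁ g₂)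
  where
  σ : Fin 2 → 𝔖
  σ = lookup (p ∷ (1 , ι 1) ∷ [])
  module S = Biorder (Inflation p21 σ)
  module T = Biorder (⟦ p ⟧ ⋆)

  f : S.Carrier → T.Carrier
  f (0F , a) = inj₁ a
  f (1F , a) = inj₂ tt
  g : T.Carrier → S.Carrier
  g (inj₁ a) = 0F , a
  g (inj₂ _) = 1F , 0F

  f₁ : ∀ u v → u S.<₁ v → f u T.<₁ f v
  f₁ (0F , a) (0F , b) (inj₂ (_ , lt)) = lt
  f₁ (0F , a) (1F , b) _ = tt
  f₁ (1F , a) (0F , b) (inj₁ ())
  f₁ (1F , a) (0F , b) (inj₂ (() , _))
  f₁ (1F , a) (1F , b) (inj₁ (s≤s ()))
  f₁ (1F , 0F) (1F , 0F) (inj₂ (_ , ()))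
  f₂ : ∀ u v → u S.<₂ v → f u T.<₂ f v
  f₂ (0F , a) (0F , b) (inj₁ (s≤s ()))
  f₂ (0F , a) (0F , b) (inj₂ (_ , lt)) = lt
  f₂ (0F , a) (1F , b) (inj₁ ())
  f₂ (0F , a) (1F , b) (inj₂ (() , _))
  f₂ (1F , a) (0F , b) _ = tt
  f₂ (1F , a) (1F , b) (inj₁ ())
  f₂ (1F , 0F) (1F , 0F) (inj₂ (_ , ()))
  gf : ∀ u → g (f u) ≡ u
  gf (0F , a)  = refl
  gf (1F , 0F) = refl
  fg : ∀ u → f (g u) ≡ u
  fg (inj₁ a) = refl
  fg (inj₂ _) = refl

  g₁ : ∀ u v → u T.<₁ v → g u S.<₁ g v
  g₁ (inj₁ a) (inj₁ b) lt = inj₂ (refl , lt)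
  g₁ (inj₁ a) (inj₂ _) _ = inj₁ z<s
  g₂ : ∀ u v → u T.<₂ v → g u S.<₂ g v
  g₂ (inj₁ a) (inj₁ b) lt = inj₂ (refl , lt)
  g₂ (inj₂ _) (inj₁ b) _ = inj₁ z<s

ι-inflation-suc : ∀ {r} (σ : Fin (suc r) → 𝔖) →
                  Inflation (ι (suc r)) σ ≋ ⟦ σ zero ⟧ ⊕ Inflation (ι r) (σ ∘ suc)
ι-inflation-suc {r} σ = mk≋ f g gf fg f₁ f₂ g₁ g₂
  where
  module S = Biorder (Inflation (ι (suc r)) σ)
  module T = Biorder (⟦ σ zero ⟧ ⊕ Inflation (ι r) (σ ∘ suc))

  f : S.Carrier → T.Carrier
  f (zero , a)  = inj₁ a
  f (suc i , a) = inj₂ (i , a)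
  g : T.Carrier → S.Carrier
  g (inj₁ a)       = zero , a
  g (inj₂ (i , a)) = suc i , a

  f₁ : ∀ u v → u S.<₁ v → f u T.<₁ f v
  f₁ (zero , a)  (zero , b)  (inj₂ (_ , lt))    = lt
  f₁ (zero , a)  (suc j , b) _                  = tt
  f₁ (suc i , a) (zero , b)  (inj₁ ())
  f₁ (suc i , a) (zero , b)  (inj₂ (() , _))
  f₁ (suc i , a) (suc j , b) (inj₁ (s≤s lt))    = inj₁ lt
  f₁ (suc i , a) (suc j , b) (inj₂ (refl , lt)) = inj₂ (refl , lt)
  f₂ : ∀ u v → u S.<₂ v → f u T.<₂ f v
  f₂ (zero , a)  (zero , b)  (inj₂ (_ , lt))    = lt
  f₂ (zero , a)  (suc j , b) _                  = tt
  f₂ (suc i , a) (zero , b)  (inj₁ ())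
  f₂ (suc i , a) (zero , b)  (inj₂ (() , _))
  f₂ (suc i , a) (suc j , b) (inj₁ (s≤s lt))    = inj₁ lt
  f₂ (suc i , a) (suc j , b) (inj₂ (refl , lt)) = inj₂ (refl , lt)
  g₁ : ∀ u v → u T.<₁ v → g u S.<₁ g v
  g₁ (inj₁ a) (inj₁ b) lt                 = inj₂ (refl , lt)
  g₁ (inj₁ a) (inj₂ v) _                  = inj₁ z<s
  g₁ (inj₂ u) (inj₂ v) (inj₁ lt)          = inj₁ (s<s lt)
  g₁ (inj₂ u) (inj₂ v) (inj₂ (refl , lt)) = inj₂ (refl , lt)
  g₂ : ∀ u v → u T.<₂ v → g u S.<₂ g v
  g₂ (inj₁ a) (inj₁ b) lt                 = inj₂ (refl , lt)
  g₂ (inj₁ a) (inj₂ v) _                  = inj₁ z<s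
  g₂ (inj₂ u) (inj₂ v) (inj₁ lt)          = inj₁ (s<s lt)
  g₂ (inj₂ u) (inj₂ v) (inj₂ (refl , lt)) = inj₂ (refl , lt)

  gf : ∀ u → g (f u) ≡ u
  gf (zero , a)  = refl
  gf (suc i , a) = refl
  fg : ∀ u → f (g u) ≡ u
  fg (inj₁ a) = refl
  fg (inj₂ u) = refl

-- The pattern of the theorem as a sum over a list, because the proof keeps cutting it into prefixes
-- and suffixes.
chain : List 𝔖 → Biorder
chain []       = 𝟘
chain (p ∷ ps) = ⟦ p ⟧ ⋆ ⊕ chain ps

ι-inflation-≋ : ∀ {r} (π : Fin r → 𝔖) → ⟦ ι r [ _* ∘ π ] ⟧ ≋ chain (tabulate π)
ι-inflation-≋ π = ≋-trans (inflation-≋ (ι _) (_* ∘ π)) (go π)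
  where
  go : ∀ {r} (π : Fin r → 𝔖) → Inflation (ι r) (_* ∘ π) ≋ chain (tabulate π)
  go {zero}  π = mk≋ (λ ()) (λ ()) (λ ()) (λ ()) (λ ()) (λ ()) (λ ()) (λ ())
  go {suc r} π = ≋-trans (ι-inflation-suc (_* ∘ π)) (⊕-cong (*-≋-⋆ (π zero)) (go (π ∘ suc)))

-- Words and their concatenation

AllPairs-++⁻ : ∀ {R : A → A → Set} us {vs} → AllPairs R (us ++ vs) →
               AllPairs R us × All (λ u → All (R u) vs) us × AllPairs R vs
AllPairs-++⁻ []       ps       = [] , [] , ps
AllPairs-++⁻ (u ∷ us) (p ∷ ps) with AllPairs-++⁻ us ps
... | pus , puv , pvs = All.++⁻ˡ us p ∷ pus , All.++⁻ʳ us p ∷ puv , pvs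

splitPos : ∀ (us vs : List A) → Fin (length (us ++ vs)) → Fin (length us) ⊎ Fin (length vs)
splitPos [] vs       i       = inj₂ i
splitPos (u ∷ us) vs zero    = inj₁ zero
splitPos (u ∷ us) vs (suc i) = Sum.map₁ suc (splitPos us vs i)

joinPos : ∀ (us vs : List A) → Fin (length us) ⊎ Fin (length vs) → Fin (length (us ++ vs))
joinPos [] vs       (inj₂ j)       = j
joinPos (u ∷ us) vs (inj₁ zero)    = zero
joinPos (u ∷ us) vs (inj₁ (suc i)) = suc (joinPos us vs (inj₁ i))
joinPos (u ∷ us) vs (inj₂ j)       = suc (joinPos us vs (inj₂ j))

joinPos-map₁ : ∀ u (us vs : List A) (s : Fin (length us) ⊎ Fin (length vs)) →
               joinPos (u ∷ us) vs (Sum.map₁ suc s) ≡ suc (joinPos us vs s)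
joinPos-map₁ u us vs (inj₁ i) = refl
joinPos-map₁ u us vs (inj₂ j) = refl

joinPos-splitPos : ∀ (us vs : List A) i → joinPos us vs (splitPos us vs i) ≡ i
joinPos-splitPos [] vs       i       = refl
joinPos-splitPos (u ∷ us) vs zero    = refl
joinPos-splitPos (u ∷ us) vs (suc i) =
  trans (joinPos-map₁ u us vs (splitPos us vs i)) (cong suc (joinPos-splitPos us vs i))

splitPos-joinPos : ∀ (us vs : List A) s → splitPos us vs (joinPos us vs s) ≡ s
splitPos-joinPos [] vs       (inj₂ j)       = refl
splitPos-joinPos (u ∷ us) vs (inj₁ zero)    = refl
splitPos-joinPos (u ∷ us) vs (inj₁ (suc i)) = cong (Sum.map₁ suc) (splitPos-joinPos us vs (inj₁ i))
splitPos-joinPos (u ∷ us) vs (inj₂ j)       = cong (Sum.map₁ suc) (splitPos-joinPos us vs (inj₂ j))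

lookup-splitPos : ∀ (us vs : List A) i →
                  lookup (us ++ vs) i ≡ [ lookup us , lookup vs ]′ (splitPos us vs i)
lookup-splitPos [] vs       i    = refl
lookup-splitPos (u ∷ us) vs zero = refl
lookup-splitPos (u ∷ us) vs (suc i) = trans (lookup-splitPos us vs i) (shift (splitPos us vs i))
  where
  shift : ∀ s → [ lookup us , lookup vs ]′ s ≡ [ lookup (u ∷ us) , lookup vs ]′ (Sum.map₁ suc s)
  shift (inj₁ i) = refl
  shift (inj₂ j) = refl

-- Letters are arbitrary naturals, so a segment of a permutation is again a word without being
-- standardised.
Word : List ℕ → Biorder
Word w = record
  { Carrier = Fin (length w)
  ; _<₁_    = Fin._<_
  ; _<₂_    = λ i j → lookup w i < lookup w j
  }

splitPos-mono : ∀ us vs i j → i Fin.< j →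
                Biorder._<₁_ (Word us ⊕ Word vs) (splitPos us vs i) (splitPos us vs j)
splitPos-mono []       vs i       j       lt       = lt
splitPos-mono (u ∷ us) vs zero    (suc j) lt       = least (splitPos us vs j)
  where
  least : ∀ t → Biorder._<₁_ (Word (u ∷ us) ⊕ Word vs) (inj₁ zero) (Sum.map₁ suc t)
  least (inj₁ y) = z<s
  least (inj₂ y) = tt
splitPos-mono (u ∷ us) vs (suc i) (suc j) (s≤s lt) =
  shift (splitPos us vs i) (splitPos us vs j) (splitPos-mono us vs i j lt)
  where
  shift : ∀ s t → Biorder._<₁_ (Word us ⊕ Word vs) s t →
          Biorder._<₁_ (Word (u ∷ us) ⊕ Word vs) (Sum.map₁ suc s) (Sum.map₁ suc t)
  shift (inj₁ x) (inj₁ y) lt = s<s lt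
  shift (inj₁ x) (inj₂ y) lt = tt
  shift (inj₂ x) (inj₂ y) lt = lt

joinPos-mono : ∀ us vs s t → Biorder._<₁_ (Word us ⊕ Word vs) s t →
               joinPos us vs s Fin.< joinPos us vs t
joinPos-mono []       vs (inj₂ i)       (inj₂ j)       lt       = lt
joinPos-mono (u ∷ us) vs (inj₁ zero)    (inj₁ (suc j)) lt       = z<s
joinPos-mono (u ∷ us) vs (inj₁ zero)    (inj₂ j)       lt       = z<s
joinPos-mono (u ∷ us) vs (inj₁ (suc i)) (inj₁ (suc j)) (s≤s lt) = s<s (joinPos-mono us vs (inj₁ i) (inj₁ j) lt)
joinPos-mono (u ∷ us) vs (inj₁ (suc i)) (inj₂ j)       lt       = s<s (joinPos-mono us vs (inj₁ i) (inj₂ j) lt)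
joinPos-mono (u ∷ us) vs (inj₂ i)       (inj₂ j)       lt       = s<s (joinPos-mono us vs (inj₂ i) (inj₂ j) lt)

module _ (us vs : List ℕ) where

  private
    P = Biorder._<₁_ (Word us ⊕ Word vs)

  value : Fin (length us) ⊎ Fin (length vs) → ℕ
  value = [ lookup us , lookup vs ]′

  -- Common part of `Word-++` and `Word-∷ʳ`: how positions split is settled here once, and each use
  -- only compares values on the two sides.
  Word-++-with : ∀ {B} (f : Fin (length us) ⊎ Fin (length vs) → Biorder.Carrier B) g →
                 (∀ x → g (f x) ≡ x) → (∀ y → f (g y) ≡ y) →
                 let module B = Biorder B in
                 (∀ s t → P s t → f s B.<₁ f t) → (∀ s t → value s < value t → f s B.<₂ f t) →
                 (∀ x y → x B.<₁ y → P (g x) (g y)) → (∀ x y → x B.<₂ y → value (g x) < value (g y)) →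
                 Word (us ++ vs) ≋ B
  Word-++-with f g gf fg f₁ f₂ g₁ g₂ = mk≋
    (f ∘ splitPos us vs) (joinPos us vs ∘ g)
    (λ i → trans (cong (joinPos us vs) (gf _)) (joinPos-splitPos us vs i))
    (λ y → trans (cong f (splitPos-joinPos us vs (g y))) (fg y))
    (λ i j lt → f₁ _ _ (splitPos-mono us vs i j lt))
    (λ i j lt → f₂ _ _ (subst₂ _<_ (lookup-splitPos us vs i) (lookup-splitPos us vs j) lt))
    (λ x y lt → joinPos-mono us vs _ _ (g₁ x y lt))
    (λ x y lt → subst₂ _<_ (sym (value-joinPos (g x))) (sym (value-joinPos (g y))) (g₂ x y lt))
    where
    value-joinPos : ∀ s → lookup (us ++ vs) (joinPos us vs s) ≡ value s
    value-joinPos s = trans (lookup-splitPos us vs (joinPos us vs s)) (cong value (splitPos-joinPos us vs s))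

Word-++ : ∀ us vs → (∀ {x y} → x ∈ us → y ∈ vs → x < y) → Word (us ++ vs) ≋ Word us ⊕ Word vs
Word-++ us vs us<vs = Word-++-with us vs id id (λ _ → refl) (λ _ → refl)
  (λ _ _ → id) f₂ (λ _ _ → id) g₂
  where
  module B = Biorder (Word us ⊕ Word vs)
  f₂ : ∀ s t → value us vs s < value us vs t → s B.<₂ t
  f₂ (inj₁ i) (inj₁ j) lt = lt
  f₂ (inj₁ i) (inj₂ j) lt = tt
  f₂ (inj₂ i) (inj₁ j) lt = ℕ.<-asym lt (us<vs (∈-lookup j) (∈-lookup i))
  f₂ (inj₂ i) (inj₂ j) lt = lt
  g₂ : ∀ s t → s B.<₂ t → value us vs s < value us vs t
  g₂ (inj₁ i) (inj₁ j) lt = lt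
  g₂ (inj₁ i) (inj₂ j) lt = us<vs (∈-lookup i) (∈-lookup j)
  g₂ (inj₂ i) (inj₂ j) lt = lt

Word-∷ʳ : ∀ us b → (∀ {x} → x ∈ us → b < x) → Word (us ++ b ∷ []) ≋ Word us ⋆
Word-∷ʳ us b b<us = Word-++-with us (b ∷ []) f g gf fg f₁ f₂ g₁ g₂
  where
  module B = Biorder (Word us ⋆)
  f : Fin (length us) ⊎ Fin 1 → B.Carrier
  f = Sum.map₂ _
  g : B.Carrier → Fin (length us) ⊎ Fin 1
  g = Sum.map₂ (λ _ → zero)
  gf : ∀ s → g (f s) ≡ s
  gf (inj₁ i)    = refl
  gf (inj₂ zero) = refl
  fg : ∀ y → f (g y) ≡ y
  fg (inj₁ i) = refl
  fg (inj₂ _) = refl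
  f₁ : ∀ s t → Biorder._<₁_ (Word us ⊕ Word (b ∷ [])) s t → f s B.<₁ f t
  f₁ (inj₁ i)    (inj₁ j)    lt = lt
  f₁ (inj₁ i)    (inj₂ j)    lt = tt
  f₁ (inj₂ zero) (inj₂ zero) ()
  f₂ : ∀ s t → value us (b ∷ []) s < value us (b ∷ []) t → f s B.<₂ f t
  f₂ (inj₁ i)    (inj₁ j)    lt = lt
  f₂ (inj₁ i)    (inj₂ zero) lt = ℕ.<-asym lt (b<us (∈-lookup i))
  f₂ (inj₂ zero) (inj₁ j)    lt = tt
  f₂ (inj₂ zero) (inj₂ zero) lt = ℕ.<-irrefl refl lt
  g₁ : ∀ x y → x B.<₁ y → Biorder._<₁_ (Word us ⊕ Word (b ∷ [])) (g x) (g y)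
  g₁ (inj₁ i) (inj₁ j) lt = lt
  g₁ (inj₁ i) (inj₂ _) lt = tt
  g₂ : ∀ x y → x B.<₂ y → value us (b ∷ []) (g x) < value us (b ∷ []) (g y)
  g₂ (inj₁ i) (inj₁ j) lt = lt
  g₂ (inj₂ _) (inj₁ j) lt = b<us (∈-lookup j)

Word-tabulate : ∀ {n} (h : Fin n → ℕ) →
                Word (tabulate h) ≋ record { Carrier = Fin n ; _<₁_ = Fin._<_ ; _<₂_ = λ i j → h i < h j }
Word-tabulate h = mk≋ to from
  (λ i → Fin.cast-involutive (sym eq) eq i)
  (λ i → Fin.cast-involutive eq (sym eq) i)
  (λ i j → subst₂ _<_ (sym (Fin.toℕ-cast _ i)) (sym (Fin.toℕ-cast _ j)))
  (λ i j → subst₂ _<_ (lookup-to i) (lookup-to j))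
  (λ i j → subst₂ _<_ (sym (Fin.toℕ-cast _ i)) (sym (Fin.toℕ-cast _ j)))
  (λ i j → subst₂ _<_ (sym (List.lookup-tabulate h i)) (sym (List.lookup-tabulate h j)))
  where
  eq = List.length-tabulate h
  to   = cast eq
  from = cast (sym eq)
  lookup-to : ∀ i → lookup (tabulate h) i ≡ h (to i)
  lookup-to i = trans (cong (lookup (tabulate h)) (sym (Fin.cast-involutive (sym eq) eq i)))
                      (List.lookup-tabulate h (to i))

-- Binary trees and the words they spell

data Tree : Set where
  leaf : Tree
  node : Tree → Tree → Tree

size : Tree → ℕ
size leaf       = 0
size (node l r) = suc (size l + size r)

shape : Tree → Biorder
shape leaf       = 𝟘
shape (node l r) = shape l ⋆ ⊕ shape r

-- The inorder reading of the preorder labels of the tree, counted from `b`.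
word : ℕ → Tree → List ℕ
word b leaf       = []
word b (node l r) = word (suc b) l ++ b ∷ word (suc b + size l) r

length-word : ∀ b t → length (word b t) ≡ size t
length-word b leaf       = refl
length-word b (node l r) = begin
  length (word (suc b) l ++ b ∷ word (suc b + size l) r)
    ≡⟨ List.length-++ (word (suc b) l) ⟩
  length (word (suc b) l) + suc (length (word (suc b + size l) r))
    ≡⟨ cong₂ (λ m n → m + suc n) (length-word _ l) (length-word _ r) ⟩
  size l + suc (size r)
    ≡⟨ ℕ.+-suc (size l) (size r) ⟩
  suc (size l + size r) ∎
  where open ≡-Reasoning

end-of-right : ∀ b l r → b + size (node l r) ≡ suc b + size l + size r
end-of-right b l r = trans (ℕ.+-suc b _) (cong suc (sym (ℕ.+-assoc b (size l) (size r))))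

end-of-left : ∀ b l r → suc b + size l ≤ b + size (node l r)
end-of-left b l r = ℕ.≤-trans (ℕ.m≤m+n _ (size r)) (ℕ.≤-reflexive (sym (end-of-right b l r)))

word-bounds : ∀ b t {x} → x ∈ word b t → b ≤ x × x < b + size t
word-bounds b (node l r) x∈ with ∈-++⁻ (word (suc b) l) x∈
... | inj₁ x∈l with word-bounds (suc b) l x∈l
...   | b<x , x<c = ℕ.<⇒≤ b<x , ℕ.<-≤-trans x<c (end-of-left b l r)
word-bounds b (node l r) x∈ | inj₂ (here refl) =
  ℕ.≤-refl , ℕ.<-≤-trans (ℕ.m≤m+n _ (size l)) (end-of-left b l r)
word-bounds b (node l r) x∈ | inj₂ (there x∈r) with word-bounds (suc b + size l) r x∈r
...   | c≤x , x<d = ℕ.≤-trans (ℕ.<⇒≤ (ℕ.m≤m+n (suc b) (size l))) c≤x ,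
                    ℕ.<-≤-trans x<d (ℕ.≤-reflexive (sym (end-of-right b l r)))

word-complete : ∀ b t {x} → b ≤ x → x < b + size t → x ∈ word b t
word-complete b leaf b≤x x<b = contradiction (ℕ.≤-<-trans b≤x (subst (_ <_) (ℕ.+-identityʳ b) x<b))
                                           (ℕ.<-irrefl refl)
word-complete b (node l r) {x} b≤x x<d with x ℕ.≟ b | x ℕ.<? suc b + size l
... | yes refl | _       = ∈-++⁺ʳ (word (suc b) l) (here refl)
... | no x≢b   | yes x<c = ∈-++⁺ˡ (word-complete (suc b) l (ℕ.≤∧≢⇒< b≤x (x≢b ∘ sym)) x<c)
... | no x≢b   | no x≮c  = ∈-++⁺ʳ (word (suc b) l) (there (word-complete (suc b + size l) r (ℕ.≮⇒≥ x≮c)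
                             (subst (x <_) (end-of-right b l r) x<d)))

word-left< : ∀ b l r {x y} → x ∈ word (suc b) l → y ∈ word (suc b + size l) r → x < y
word-left< b l r x∈ y∈ = ℕ.<-≤-trans (proj₂ (word-bounds _ l x∈)) (proj₁ (word-bounds _ r y∈))

word-root< : ∀ b l r {y} → y ∈ word (suc b + size l) r → b < y
word-root< b l r y∈ = ℕ.≤-trans (ℕ.m≤m+n (suc b) (size l)) (proj₁ (word-bounds _ r y∈))

word-unique : ∀ b t → Unique (word b t)
word-unique b leaf       = []
word-unique b (node l r) = AllPairs.++⁺ (word-unique _ l)
  (All.tabulate (λ y∈ → ℕ.<⇒≢ (word-root< b l r y∈)) ∷ word-unique _ r)
  (All.tabulate λ x∈ → (ℕ.<⇒≢ (proj₁ (word-bounds _ l x∈)) ∘ sym) ∷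
     All.tabulate λ y∈ → ℕ.<⇒≢ (word-left< b l r x∈ y∈))

Word-word : ∀ b t → Word (word b t) ≋ shape t
Word-word b leaf       = mk≋ (λ ()) (λ ()) (λ ()) (λ ()) (λ ()) (λ ()) (λ ()) (λ ())
Word-word b (node l r) = subst (λ w → Word w ≋ shape (node l r))
  (List.++-assoc (word (suc b) l) (b ∷ []) (word (suc b + size l) r)) $
  ≋-trans (Word-++ (word (suc b) l ++ b ∷ []) _ lt)
    (⊕-cong (≋-trans (Word-∷ʳ (word (suc b) l) b (proj₁ ∘ word-bounds _ l)) (⋆-cong (Word-word _ l)))
            (Word-word _ r))
  where
  lt : ∀ {x y} → x ∈ word (suc b) l ++ b ∷ [] → y ∈ word (suc b + size l) r → x < y
  lt x∈ y∈ with ∈-++⁻ (word (suc b) l) x∈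
  ... | inj₁ x∈l         = word-left< b l r x∈l y∈
  ... | inj₂ (here refl) = word-root< b l r y∈

++-unique-split : ∀ {b} us us′ {vs vs′ : List A} → b ∉ us → b ∉ us′ →
                  us ++ b ∷ vs ≡ us′ ++ b ∷ vs′ → us ≡ us′ × vs ≡ vs′
++-unique-split []       []         _    _     refl = refl , refl
++-unique-split []       (_ ∷ us′)  _    b∉us′ refl = contradiction (here refl) b∉us′
++-unique-split (_ ∷ us) []         b∉us _     refl = contradiction (here refl) b∉us
++-unique-split (u ∷ us) (u′ ∷ us′) b∉us b∉us′ eq
  with refl , eq′ ← List.∷-injective eq
  with refl , eq″ ← ++-unique-split us us′ (b∉us ∘ there) (b∉us′ ∘ there) eq′ = refl , eq″

-- The letter `b` is absent from the word of the left subtree, so its first occurrence marks the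
-- root and separates the two subwords.
word-injective : ∀ b t t′ → word b t ≡ word b t′ → t ≡ t′
word-injective b leaf       leaf         eq = refl
word-injective b leaf       (node l r)   eq with () ← List.++-conicalʳ (word (suc b) l) _ (sym eq)
word-injective b (node l r) leaf         eq with () ← List.++-conicalʳ (word (suc b) l) _ eq
word-injective b (node l r) (node l′ r′) eq
  with eqˡ , eqʳ ← ++-unique-split (word (suc b) l) (word (suc b) l′)
                     (ℕ.<-irrefl refl ∘ proj₁ ∘ word-bounds _ l)
                     (ℕ.<-irrefl refl ∘ proj₁ ∘ word-bounds _ l′) eq
  -- Only once the left subtrees agree do the two right words start from the same base.
  with refl ← word-injective _ l l′ eqˡ
  with refl ← word-injective _ r r′ eqʳ = refl

-- Permutations as words

code : ∀ {n} → Permutation′ n → List ℕ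
code σ = tabulate (λ i → toℕ (σ ⟨$⟩ʳ i))

Word-code : ∀ {n} (σ : Permutation′ n) → Word (code σ) ≋ ⟦ n , σ ⟧
Word-code σ = Word-tabulate (λ i → toℕ (σ ⟨$⟩ʳ i))

tabulate-injective : ∀ {n} {f g : Fin n → A} → tabulate f ≡ tabulate g → f ≗ g
tabulate-injective eq zero    = List.∷-injectiveˡ eq
tabulate-injective eq (suc i) = tabulate-injective (List.∷-injectiveʳ eq) i

lookup-injective : ∀ {us : List A} → Unique us → ∀ i j → lookup us i ≡ lookup us j → i ≡ j
lookup-injective (u∉ ∷ _)  zero    zero    eq = refl
lookup-injective (u∉ ∷ _)  zero    (suc j) eq = contradiction eq (All.lookup u∉ (∈-lookup j))
lookup-injective (u∉ ∷ _)  (suc i) zero    eq = contradiction (sym eq) (All.lookup u∉ (∈-lookup i))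
lookup-injective (_ ∷ us!) (suc i) (suc j) eq = cong suc (lookup-injective us! i j eq)

-- The inverse sends a value to the place where it stands in `w`; distinctness of the letters makes
-- this place unique.
code-surjective : ∀ {w} → Unique w → (∀ {x} → x ∈ w → x < length w) →
                  (∀ {x} → x < length w → x ∈ w) →
                  ∃ λ (σ : Permutation′ (length w)) → code σ ≡ w
code-surjective {w} w! bound all =
  permutation f g fg gf ,
  trans (List.tabulate-cong (λ i → Fin.toℕ-fromℕ< (bound (∈-lookup i)))) (List.tabulate-lookup w)
  where
  f g : Fin (length w) → Fin (length w)
  f i = fromℕ< (bound (∈-lookup i))
  g x = index (all (Fin.toℕ<n x))
  fg : ∀ x → f (g x) ≡ x
  fg x = Fin.toℕ-injective (trans (Fin.toℕ-fromℕ< _) (sym (lookup-index (all (Fin.toℕ<n x)))))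
  gf : ∀ i → g (f i) ≡ i
  gf i = lookup-injective w! _ _
    (trans (sym (lookup-index (all (Fin.toℕ<n (f i))))) (Fin.toℕ-fromℕ< _))

word-code : ∀ t → ∃ λ (σ : Permutation′ (size t)) → code σ ≡ word 0 t
word-code t = subst (λ n → ∃ λ (σ : Permutation′ n) → code σ ≡ word 0 t) (length-word 0 t)
  (code-surjective (word-unique 0 t)
    (λ x∈ → subst (_ <_) (sym (length-word 0 t)) (proj₂ (word-bounds 0 t x∈)))
    (λ x< → word-complete 0 t z≤n (subst (_ <_) (length-word 0 t) x<)))

code-shape : ∀ {n} (σ : Permutation′ n) t → code σ ≡ word 0 t → ⟦ n , σ ⟧ ≋ shape t
code-shape σ t eq =
  ≋-trans (≋-sym (Word-code σ)) (subst (λ w → Word w ≋ shape t) (sym eq) (Word-word 0 t))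
  where
  ≋-sym : ∀ {A B} → A ≋ B → B ≋ A
  ≋-sym (f , g) = g , f

abstract
  -- `shape t` and the permutation spelled by `t` embed into each other, and for that permutation
  -- containment is decided by search.
  occurs? : ∀ p t → Dec (⟦ p ⟧ ⊑ shape t)
  occurs? p t with word-code t
  ... | σ , eq with code-shape σ t eq
  ...   | f , g = map′ (λ c → ⊑-trans (contains⇒⊑ σ p c) f)
                         (λ h → ⊑⇒contains σ p (⊑-trans h g)) (contains? σ p)

-- The 312-avoiders are the permutations spelled by trees

Avoids312 : Biorder → Set
Avoids312 B = ∀ x y z → x <₁ y → y <₁ z → y <₂ z → ¬ z <₂ x
  where open Biorder B

-- The first letter of a 312 exceeds the other two, so an occurrence stays within one summand. The
-- root, last in `shape l ⋆`, could only be its 2, yet it is least there.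
shape-avoids312 : ∀ t → Avoids312 (shape t)
shape-avoids312 (node l r) (inj₁ (inj₁ x)) (inj₁ (inj₁ y)) (inj₁ (inj₁ z)) = shape-avoids312 l x y z
shape-avoids312 (node l r) (inj₁ (inj₁ x)) (inj₁ (inj₁ y)) (inj₁ (inj₂ _)) _ _ ()
shape-avoids312 (node l r) (inj₁ (inj₁ x)) (inj₁ (inj₂ _)) (inj₁ _) _ ()
shape-avoids312 (node l r) (inj₁ (inj₂ _)) (inj₁ y) (inj₁ _) ()
shape-avoids312 (node l r) (inj₁ x) (inj₁ y) (inj₂ z) _ _ _ ()
shape-avoids312 (node l r) (inj₁ x) (inj₂ y) (inj₂ z) _ _ _ ()
shape-avoids312 (node l r) (inj₂ x) (inj₂ y) (inj₂ z) = shape-avoids312 r x y z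

Avoids312⇒avoids : ∀ {B} → Avoids312 B → ¬ (⟦ p312 ⟧ ⊑ B)
Avoids312⇒avoids av f = av _ _ _ (mono₁ f 0F 1F z<s) (mono₁ f 1F 2F (s<s z<s))
                               (mono₂ f 1F 2F z<s) (mono₂ f 2F 0F (s<s z<s))
  where open _⊑_

avoids⇒Avoids312 : ∀ {n} (σ : Permutation′ n) → ¬ Contains σ p312 → Avoids312 ⟦ n , σ ⟧
avoids⇒Avoids312 {n} σ av x y z x<y y<z σy<σz σz<σx = av (e , mono , iso)
  where
  e : Fin 3 → Fin n
  e 0F = x
  e 1F = y
  e 2F = z
  mono : ∀ i j → i Fin.< j → e i Fin.< e j
  mono 0F 1F _ = x<y
  mono 0F 2F _ = ℕ.<-trans x<y y<z
  mono 1F 2F _ = y<z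
  mono 1F 1F (s≤s ())
  mono 2F 1F (s≤s ())
  mono 2F 2F (s≤s (s≤s ()))
  σy<σx = ℕ.<-trans σy<σz σz<σx
  iso : ∀ i j → _
  iso 0F 0F = mk⇔ (⊥-elim ∘ ℕ.<-irrefl refl) (⊥-elim ∘ ℕ.<-irrefl refl)
  iso 0F 1F = mk⇔ (λ ()) (⊥-elim ∘ ℕ.<-asym σy<σx)
  iso 0F 2F = mk⇔ (λ { (s≤s ()) }) (⊥-elim ∘ ℕ.<-asym σz<σx)
  iso 1F 0F = mk⇔ (λ _ → σy<σx) (λ _ → z<s)
  iso 1F 1F = mk⇔ (⊥-elim ∘ ℕ.<-irrefl refl) (⊥-elim ∘ ℕ.<-irrefl refl)
  iso 1F 2F = mk⇔ (λ _ → σy<σz) (λ _ → z<s)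
  iso 2F 0F = mk⇔ (λ _ → σz<σx) (λ _ → s<s z<s)
  iso 2F 1F = mk⇔ (λ ()) (⊥-elim ∘ ℕ.<-asym σy<σz)
  iso 2F 2F = mk⇔ (⊥-elim ∘ ℕ.<-irrefl refl) (⊥-elim ∘ ℕ.<-irrefl refl)

No312 : List ℕ → Set
No312 []       = ⊤
No312 (x ∷ xs) = AllPairs (λ y z → y < z → ¬ z < x) xs × No312 xs

tabulate-no312 : ∀ {n} (h : Fin n → ℕ) →
                 (∀ i j k → i Fin.< j → j Fin.< k → h j < h k → ¬ h k < h i) → No312 (tabulate h)
tabulate-no312 {zero}  h av = tt
tabulate-no312 {suc n} h av =
  AllPairs.tabulate⁺-< (λ j<k → av zero _ _ z<s (s<s j<k)) ,
  tabulate-no312 (h ∘ suc) (λ i j k i<j j<k → av _ _ _ (s<s i<j) (s<s j<k))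

-- The crossing condition is avoidance with `b` as the 1: for x on the left and z on the right, x b
-- z must not have the order 312.
No312-++⁻ : ∀ us {b vs} → No312 (us ++ b ∷ vs) →
            No312 us × All (λ x → All (λ z → b < z → ¬ z < x) vs) us × No312 vs
No312-++⁻ []       (_ , av) = tt , [] , av
No312-++⁻ (u ∷ us) (ps , av) with AllPairs-++⁻ us ps | No312-++⁻ us av
... | pus , _ , (pb ∷ _) | av-us , cross , av-vs = (pus , av-us) , pb ∷ cross , av-vs

-- A word on the interval [b, c) splits at its least letter b; avoidance puts the letters
-- on the left below those on the right, so both sides are again words on intervals.
word-surjective : ∀ k {w} → length w ≤ k → ∀ {b c} → b ≤ c → Unique w →
                  (∀ {x} → x ∈ w → b ≤ x × x < c) → (∀ {x} → b ≤ x → x < c → x ∈ w) →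
                  No312 w → ∃ λ t → word b t ≡ w × b + size t ≡ c
word-surjective k {w} len {b} {c} b≤c w! bound all av with b ℕ.<? c
word-surjective k {[]} len b≤c w! bound all av | no b≮c =
  leaf , refl , trans (ℕ.+-identityʳ _) (ℕ.≤-antisym b≤c (ℕ.≮⇒≥ b≮c))
word-surjective k {x ∷ w} len b≤c w! bound all av | no b≮c =
  contradiction (uncurry ℕ.≤-<-trans (bound (here refl))) b≮c
... | yes b<c with ∈-∃++ (all ℕ.≤-refl b<c)
word-surjective zero    len b≤c w! bound all av | yes b<c | [] , vs , refl with () ← len
word-surjective zero    len b≤c w! bound all av | yes b<c | (_ ∷ _) , vs , refl with () ← len
word-surjective (suc k) len {b} {c} b≤c w! bound all av | yes b<c | us , vs , refl
  with us! , us≢ , (b∉vs ∷ vs!) ← AllPairs-++⁻ us w!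
  with av-us , cross , av-vs ← No312-++⁻ us av
  -- Both sides are shorter than `w` without being subterms of it, so the recursion runs on the
  -- length bound.
  = join (word-surjective k (ℕ.≤-trans (ℕ.m≤m+n _ _) len′) b<m us! bound-us all-us av-us)
         (word-surjective k (ℕ.≤-trans (ℕ.m≤n+m _ _) len′) m≤c vs! bound-vs all-vs av-vs)
  where
  len′ : length us + length vs ≤ k
  len′ = s≤s⁻¹ (subst (_≤ suc k) (trans (List.length-++ us) (ℕ.+-suc _ _)) len)

  -- The border between the two intervals: one past the greatest letter on the left, and `suc b`
  -- when the left side is empty, through the default `b` of `max`.
  m : ℕ
  m = suc (max b us)
  b<m : b < m
  b<m = s≤s (⊥≤max b us)

  b<v : ∀ {y} → y ∈ vs → b < y
  b<v y∈ = ℕ.≤∧≢⇒< (proj₁ (bound (∈-++⁺ʳ us (there y∈)))) (All.lookup b∉vs y∈)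
  u<v : ∀ {x y} → x ∈ us → y ∈ vs → x < y
  u<v x∈ y∈ = ℕ.≤∧≢⇒< (ℕ.≮⇒≥ (All.lookup (All.lookup cross x∈) y∈ (b<v y∈)))
                        (All.lookup (All.lookup us≢ x∈) (there y∈))

  bound-us : ∀ {x} → x ∈ us → suc b ≤ x × x < m
  bound-us x∈ = ℕ.≤∧≢⇒< (proj₁ (bound (∈-++⁺ˡ x∈))) (All.lookup (All.lookup us≢ x∈) (here refl) ∘ sym) ,
                s≤s (All.lookup (xs≤max b us) x∈)

  m≤v : ∀ {y} → y ∈ vs → m ≤ y
  m≤v y∈ with argmax-sel id b us
  ... | inj₁ eq = subst (_< _) (sym eq) (b<v y∈)
  ... | inj₂ m∈ = u<v m∈ y∈
  m≤c : m ≤ c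
  m≤c with argmax-sel id b us
  ... | inj₁ eq = subst (_< c) (sym eq) b<c
  ... | inj₂ m∈ = proj₂ (bound (∈-++⁺ˡ m∈))
  bound-vs : ∀ {y} → y ∈ vs → m ≤ y × y < c
  bound-vs y∈ = m≤v y∈ , proj₂ (bound (∈-++⁺ʳ us (there y∈)))

  all-us : ∀ {x} → suc b ≤ x → x < m → x ∈ us
  all-us b<x x<m with ∈-++⁻ us (all (ℕ.<⇒≤ b<x) (ℕ.<-≤-trans x<m m≤c))
  ... | inj₁ x∈          = x∈
  ... | inj₂ (here refl) = contradiction b<x (ℕ.<-irrefl refl)
  ... | inj₂ (there x∈)  = contradiction (m≤v x∈) (ℕ.<⇒≱ x<m)
  all-vs : ∀ {x} → m ≤ x → x < c → x ∈ vs
  all-vs m≤x x<c with ∈-++⁻ us (all (ℕ.<⇒≤ (ℕ.<-≤-trans b<m m≤x)) x<c)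
  ... | inj₁ x∈          = contradiction (proj₂ (bound-us x∈)) (ℕ.≤⇒≯ m≤x)
  ... | inj₂ (here refl) = contradiction b<m (ℕ.≤⇒≯ m≤x)
  ... | inj₂ (there x∈)  = x∈

  join : (∃ λ l → word (suc b) l ≡ us × suc b + size l ≡ m) →
         (∃ λ r → word m r ≡ vs × m + size r ≡ c) →
         ∃ λ t → word b t ≡ us ++ b ∷ vs × b + size t ≡ c
  join (l , refl , eqₗ) (r , eq , eqᵣ) = node l r ,
    cong (λ v → word (suc b) l ++ b ∷ v) (trans (cong (λ a → word a r) eqₗ) eq) ,
    trans (end-of-right b l r) (trans (cong (_+ size r) eqₗ) eqᵣ)

code-word : ∀ {n} (σ : Permutation′ n) → ¬ Contains σ p312 → ∃ λ t → code σ ≡ word 0 t × size t ≡ n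
code-word {n} σ av with word-surjective (length (code σ)) ℕ.≤-refl z≤n unique
    (λ x∈ → z≤n , bound x∈) (λ _ → all) (tabulate-no312 _ (avoids⇒Avoids312 σ av))
  where
  σ-injective : ∀ {i j} → toℕ (σ ⟨$⟩ʳ i) ≡ toℕ (σ ⟨$⟩ʳ j) → i ≡ j
  σ-injective eq = Injection.injective (↔⇒↣ σ) (Fin.toℕ-injective eq)
  unique : Unique (code σ)
  unique = AllPairs.tabulate⁺ (λ i≢j → i≢j ∘ σ-injective)
  bound : ∀ {x} → x ∈ code σ → x < n
  bound x∈ with ∈-tabulate⁻ x∈
  ... | i , refl = Fin.toℕ<n _
  all : ∀ {x} → x < n → x ∈ code σ
  all x<n = subst (_∈ code σ)
    (trans (cong toℕ (Inverse.inverseˡ σ refl)) (Fin.toℕ-fromℕ< x<n))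
    (∈-tabulate⁺ (Inverse.from σ (fromℕ< x<n)))
... | t , eq , size≡ = t , sym eq , size≡

-- Finite sums

∑ : List A → (A → ℕ) → ℕ
∑ xs f = sum (map f xs)

∑-cong : ∀ {f g : A → ℕ} xs → (∀ {x} → x ∈ xs → f x ≡ g x) → ∑ xs f ≡ ∑ xs g
∑-cong []       eq = refl
∑-cong (x ∷ xs) eq = cong₂ _+_ (eq (here refl)) (∑-cong xs (eq ∘ there))

∑-++ : ∀ (f : A → ℕ) xs {ys} → ∑ (xs ++ ys) f ≡ ∑ xs f + ∑ ys f
∑-++ f xs {ys} = trans (cong sum (List.map-++ f xs ys)) (sum-++ (map f xs) (map f ys))

∑-map : ∀ (f : B → ℕ) (g : A → B) xs → ∑ (map g xs) f ≡ ∑ xs (f ∘ g)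
∑-map f g xs = cong sum (sym (List.map-∘ xs))

∑-concatMap : ∀ (f : B → ℕ) (g : A → List B) xs → ∑ (concatMap g xs) f ≡ ∑ xs (λ x → ∑ (g x) f)
∑-concatMap f g []       = refl
∑-concatMap f g (x ∷ xs) = trans (∑-++ f (g x)) (cong (∑ (g x) f +_) (∑-concatMap f g xs))

∑-product : ∀ (f : C → ℕ) (g : A → B → C) xs ys →
            ∑ (cartesianProductWith g xs ys) f ≡ ∑ xs (λ x → ∑ ys (λ y → f (g x y)))
∑-product f g []       ys = refl
∑-product f g (x ∷ xs) ys = trans (∑-++ f (map (g x) ys)) (cong₂ _+_ (∑-map f (g x) ys) (∑-product f g xs ys))

∑-+ : ∀ (f g : A → ℕ) xs → ∑ xs (λ x → f x + g x) ≡ ∑ xs f + ∑ xs g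
∑-+ f g []       = refl
∑-+ f g (x ∷ xs) = begin
  f x + g x + ∑ xs (λ x → f x + g x) ≡⟨ cong (f x + g x +_) (∑-+ f g xs) ⟩
  f x + g x + (∑ xs f + ∑ xs g)      ≡⟨ interchange ℕ.+-commutativeSemigroup (f x) (g x) (∑ xs f) (∑ xs g) ⟩
  f x + ∑ xs f + (g x + ∑ xs g)      ∎
  where
  open ≡-Reasoning

∑-0 : ∀ (xs : List A) → ∑ xs (λ _ → 0) ≡ 0
∑-0 []       = refl
∑-0 (x ∷ xs) = ∑-0 xs

∑-filter : ∀ {P : A → Set} (P? : ∀ x → Dec (P x)) (f : A → ℕ) xs →
           ∑ (filter P? xs) f ≡ ∑ xs (λ x → if does (P? x) then f x else 0)
∑-filter P? f []       = refl
∑-filter P? f (x ∷ xs) with does (P? x)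
... | true  = cong (f x +_) (∑-filter P? f xs)
... | false = ∑-filter P? f xs

length-∑ : ∀ (xs : List A) → length xs ≡ ∑ xs (λ _ → 1)
length-∑ []       = refl
length-∑ (x ∷ xs) = cong suc (length-∑ xs)

-- Inversions of permutations, words and trees

below : ℕ → List ℕ → ℕ
below x ys = ∑ ys (λ y → if does (y ℕ.<? x) then 1 else 0)

invWord : List ℕ → ℕ
invWord []       = 0
invWord (x ∷ xs) = below x xs + invWord xs

inv-code : ∀ {n} (σ : Permutation′ n) → inv σ ≡ invWord (code σ)
inv-code {n} σ = begin
  inv σ
    ≡⟨ length-∑ (filter P? (cartesianProduct (allFin n) (allFin n))) ⟩
  ∑ (filter P? (cartesianProduct (allFin n) (allFin n))) (λ _ → 1)
    ≡⟨ ∑-filter P? (λ _ → 1) (cartesianProduct (allFin n) (allFin n)) ⟩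
  ∑ (cartesianProduct (allFin n) (allFin n)) (λ p → if does (P? p) then 1 else 0)
    ≡⟨ ∑-product _ _,_ (allFin n) (allFin n) ⟩
  ∑ (allFin n) (λ i → ∑ (allFin n) (λ j → if does (P? (i , j)) then 1 else 0))
    ≡⟨ go (λ i → toℕ (σ ⟨$⟩ʳ i)) ⟩
  invWord (code σ) ∎
  where
  open ≡-Reasoning
  P? : ((i , j) : Fin n × Fin n) → Dec (i Fin.< j × σ ⟨$⟩ʳ j Fin.< σ ⟨$⟩ʳ i)
  P? (i , j) = i Fin.<? j ×-dec σ ⟨$⟩ʳ j Fin.<? σ ⟨$⟩ʳ i

  ∑-allFin : ∀ {n} (f : Fin (suc n) → ℕ) → ∑ (allFin (suc n)) f ≡ f zero + ∑ (allFin n) (f ∘ suc)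
  ∑-allFin f = cong (λ xs → f zero + sum xs) (trans (List.map-tabulate suc f) (sym (List.map-tabulate id (f ∘ suc))))

  go : ∀ {n} (h : Fin n → ℕ) →
       ∑ (allFin n) (λ i → ∑ (allFin n) (λ j → if does (i Fin.<? j ×-dec h j ℕ.<? h i) then 1 else 0)) ≡
       invWord (tabulate h)
  go {zero}  h = refl
  go {suc n} h = trans (∑-allFin row) (cong₂ _+_ top (trans rest (go (h ∘ suc))))
    where
    row : Fin (suc n) → ℕ
    row i = ∑ (allFin (suc n)) (λ j → if does (i Fin.<? j ×-dec h j ℕ.<? h i) then 1 else 0)
    top : row zero ≡ below (h zero) (tabulate (h ∘ suc))
    top = trans (∑-allFin (λ j → if does (zero {n} Fin.<? j ×-dec h j ℕ.<? h zero) then 1 else 0))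
            (trans (cong sum (List.map-tabulate id (λ j → if does (h (suc j) ℕ.<? h zero) then 1 else 0)))
                   (cong sum (sym (List.map-tabulate (h ∘ suc) _))))
    -- The entry of a later row in column `zero` computes to 0, as no position is less than `zero`.
    rest : ∑ (allFin n) (row ∘ suc) ≡
           ∑ (allFin n) (λ i → ∑ (allFin n) (λ j → if does (i Fin.<? j ×-dec h (suc j) ℕ.<? h (suc i)) then 1 else 0))
    rest = ∑-cong (allFin n) λ {i} _ → ∑-allFin (λ j → if does (suc i Fin.<? j ×-dec h j ℕ.<? h (suc i)) then 1 else 0)

invTree : Tree → ℕ
invTree leaf       = 0
invTree (node l r) = invTree l + size l + invTree r

below≡0 : ∀ {x} ys → (∀ {y} → y ∈ ys → x < y) → below x ys ≡ 0
below≡0 {x} ys x<ys = trans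
  (∑-cong ys λ y∈ → cong (λ b → if b then 1 else 0) (dec-false (_ ℕ.<? x) (ℕ.<-asym (x<ys y∈))))
  (∑-0 ys)

-- Every letter of `us` stands before the smaller `b`, which gives `length us` inversions; each
-- letter of `vs` exceeds everything before `vs`, so no other inversion crosses.
invWord-++ : ∀ us {b vs} → (∀ {x} → x ∈ us → b < x) → (∀ {y} → y ∈ vs → b < y) →
             (∀ {x y} → x ∈ us → y ∈ vs → x < y) →
             invWord (us ++ b ∷ vs) ≡ invWord us + length us + invWord vs
invWord-++ []       {b} {vs} b<us b<vs us<vs = cong (_+ invWord vs) (below≡0 vs b<vs)
invWord-++ (x ∷ us) {b} {vs} b<us b<vs us<vs = begin
  below x (us ++ b ∷ vs) + invWord (us ++ b ∷ vs)
    ≡⟨ cong₂ _+_ below-x (invWord-++ us (b<us ∘ there) b<vs (us<vs ∘ there)) ⟩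
  (below x us + 1) + (invWord us + length us + invWord vs)
    ≡⟨ solve 4 (λ a i n v → (a :+ con 1) :+ (i :+ n :+ v) := ((a :+ i) :+ (con 1 :+ n)) :+ v)
         refl (below x us) (invWord us) (length us) (invWord vs) ⟩
  (below x us + invWord us) + suc (length us) + invWord vs ∎
  where
  open ≡-Reasoning
  open +-*-Solver
  below-x : below x (us ++ b ∷ vs) ≡ below x us + 1
  below-x = trans (∑-++ _ us) (cong (below x us +_)
    (cong₂ _+_ (cong (λ c → if c then 1 else 0) (dec-true (b ℕ.<? x) (b<us (here refl))))
               (below≡0 vs (us<vs (here refl)))))

invWord-word : ∀ b t → invWord (word b t) ≡ invTree t
invWord-word b leaf       = refl
invWord-word b (node l r) = begin
  invWord (word b (node l r))
    ≡⟨ invWord-++ (word (suc b) l) (proj₁ ∘ word-bounds _ l) (word-root< b l r) (word-left< b l r) ⟩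
  invWord (word (suc b) l) + length (word (suc b) l) + invWord (word (suc b + size l) r)
    ≡⟨ cong₂ _+_ (cong₂ _+_ (invWord-word _ l) (length-word _ l)) (invWord-word _ r) ⟩
  invTree (node l r) ∎
  where open ≡-Reasoning

-- Embeddings of chains into sums

⊑-⊕ˡ : ∀ {A B} → A ⊑ A ⊕ B
⊑-⊕ˡ = record { fun = inj₁ ; mono₁ = λ _ _ → id ; mono₂ = λ _ _ → id ; refl₂ = λ _ _ → id }

⊑-⊕ʳ : ∀ {A B} → B ⊑ A ⊕ B
⊑-⊕ʳ = record { fun = inj₂ ; mono₁ = λ _ _ → id ; mono₂ = λ _ _ → id ; refl₂ = λ _ _ → id }

⊑-⋆ : ∀ {A} → A ⊑ A ⋆
⊑-⋆ = record { fun = inj₁ ; mono₁ = λ _ _ → id ; mono₂ = λ _ _ → id ; refl₂ = λ _ _ → id }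

𝟘-⊑ : ∀ {A} → 𝟘 ⊑ A
𝟘-⊑ = record { fun = λ () ; mono₁ = λ () ; mono₂ = λ () ; refl₂ = λ () }

⊕-assoc : ∀ {A B C} → (A ⊕ B) ⊕ C ≋ A ⊕ (B ⊕ C)
⊕-assoc {A} {B} {C} = mk≋ Sum.assocʳ Sum.assocˡ gf fg f₁ f₂ g₁ g₂
  where
  module S = Biorder ((A ⊕ B) ⊕ C)
  module T = Biorder (A ⊕ (B ⊕ C))
  gf : ∀ x → Sum.assocˡ (Sum.assocʳ x) ≡ x
  gf (inj₁ (inj₁ x)) = refl
  gf (inj₁ (inj₂ x)) = refl
  gf (inj₂ x)        = refl
  fg : ∀ x → Sum.assocʳ (Sum.assocˡ x) ≡ x
  fg (inj₁ x)        = refl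
  fg (inj₂ (inj₁ x)) = refl
  fg (inj₂ (inj₂ x)) = refl
  f₁ : ∀ x y → x S.<₁ y → Sum.assocʳ x T.<₁ Sum.assocʳ y
  f₁ (inj₁ (inj₁ x)) (inj₁ (inj₁ y)) lt = lt
  f₁ (inj₁ (inj₁ x)) (inj₁ (inj₂ y)) lt = lt
  f₁ (inj₁ (inj₁ x)) (inj₂ y)        lt = lt
  f₁ (inj₁ (inj₂ x)) (inj₁ (inj₂ y)) lt = lt
  f₁ (inj₁ (inj₂ x)) (inj₂ y)        lt = lt
  f₁ (inj₂ x)        (inj₂ y)        lt = lt
  f₂ : ∀ x y → x S.<₂ y → Sum.assocʳ x T.<₂ Sum.assocʳ y
  f₂ (inj₁ (inj₁ x)) (inj₁ (inj₁ y)) lt = lt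
  f₂ (inj₁ (inj₁ x)) (inj₁ (inj₂ y)) lt = lt
  f₂ (inj₁ (inj₁ x)) (inj₂ y)        lt = lt
  f₂ (inj₁ (inj₂ x)) (inj₁ (inj₂ y)) lt = lt
  f₂ (inj₁ (inj₂ x)) (inj₂ y)        lt = lt
  f₂ (inj₂ x)        (inj₂ y)        lt = lt
  g₁ : ∀ x y → x T.<₁ y → Sum.assocˡ x S.<₁ Sum.assocˡ y
  g₁ (inj₁ x)        (inj₁ y)        lt = lt
  g₁ (inj₁ x)        (inj₂ (inj₁ y)) lt = lt
  g₁ (inj₁ x)        (inj₂ (inj₂ y)) lt = lt
  g₁ (inj₂ (inj₁ x)) (inj₂ (inj₁ y)) lt = lt
  g₁ (inj₂ (inj₁ x)) (inj₂ (inj₂ y)) lt = lt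
  g₁ (inj₂ (inj₂ x)) (inj₂ (inj₂ y)) lt = lt
  g₂ : ∀ x y → x T.<₂ y → Sum.assocˡ x S.<₂ Sum.assocˡ y
  g₂ (inj₁ x)        (inj₁ y)        lt = lt
  g₂ (inj₁ x)        (inj₂ (inj₁ y)) lt = lt
  g₂ (inj₁ x)        (inj₂ (inj₂ y)) lt = lt
  g₂ (inj₂ (inj₁ x)) (inj₂ (inj₁ y)) lt = lt
  g₂ (inj₂ (inj₁ x)) (inj₂ (inj₂ y)) lt = lt
  g₂ (inj₂ (inj₂ x)) (inj₂ (inj₂ y)) lt = lt

-- An embedding whose image lies in that of `g` corestricts to `C`. Reflection of positions along
-- `g` is a separate hypothesis, since `_⊑_` records reflection for values alone.
⊑-factor : ∀ {A B C} (f : A ⊑ B) (g : C ⊑ B) (h : Carrier A → Carrier C) →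
           (∀ {x y} → Biorder._<₁_ B (fun g x) (fun g y) → Biorder._<₁_ C x y) →
           (∀ x → fun f x ≡ fun g (h x)) → A ⊑ C
⊑-factor {A} {B} {C} f g h refl₁ eq = record
  { fun   = h
  ; mono₁ = λ x y lt → refl₁ (subst₂ (Biorder._<₁_ B) (eq x) (eq y) (mono₁ f x y lt))
  ; mono₂ = λ x y lt → refl₂ g _ _ (subst₂ (Biorder._<₂_ B) (eq x) (eq y) (mono₂ f x y lt))
  ; refl₂ = λ x y lt → refl₂ f x y (subst₂ (Biorder._<₂_ B) (sym (eq x)) (sym (eq y)) (mono₂ g _ _ lt))
  }

Left : {X Y : Set} → X ⊎ Y → Set
Left s = ∃ λ x → s ≡ inj₁ x

Right : {X Y : Set} → X ⊎ Y → Set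
Right s = ∃ λ y → s ≡ inj₂ y

restrictˡ : ∀ {A B C} (f : A ⊑ B ⊕ C) → (∀ x → Left (fun f x)) → A ⊑ B
restrictˡ f left = ⊑-factor f ⊑-⊕ˡ (proj₁ ∘ left) id (proj₂ ∘ left)

restrictʳ : ∀ {A B C} (f : A ⊑ B ⊕ C) → (∀ x → Right (fun f x)) → A ⊑ C
restrictʳ f right = ⊑-factor f ⊑-⊕ʳ (proj₁ ∘ right) id (proj₂ ∘ right)

restrict⋆ : ∀ {A B} (f : A ⊑ B ⋆) → (∀ x → Left (fun f x)) → A ⊑ B
restrict⋆ f left = ⊑-factor f ⊑-⋆ (proj₁ ∘ left) id (proj₂ ∘ left)

-- The least and last element of ⟦ p ⟧ ⋆ decides on which side all of ⟦ p ⟧ ⋆ lies.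
⊕-split-from : ∀ {A B C} qs (f : A ⊕ chain qs ⊑ B ⊕ C) → (∀ a → Left (fun f (inj₁ a))) →
               ∃₂ λ qs₁ qs₂ → qs ≡ qs₁ ++ qs₂ × A ⊕ chain qs₁ ⊑ B × chain qs₂ ⊑ C
⊕-split-from [] f left = [] , [] , refl , restrictˡ f (λ { (inj₁ a) → left a }) , 𝟘-⊑
⊕-split-from {A} {B} {C} (p ∷ qs) f left = by-root (fun f (inj₂ (inj₁ (inj₂ tt)))) refl
  where
  module D = Biorder (B ⊕ C)
  root : Carrier (A ⊕ chain (p ∷ qs))
  root = inj₂ (inj₁ (inj₂ tt))

  left-before : ∀ {b} u → fun f root ≡ inj₁ b → u D.<₁ fun f root → Left u
  left-before (inj₁ x) eq lt = x , refl
  left-before (inj₂ y) eq lt = ⊥-elim (subst (inj₂ y D.<₁_) eq lt)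

  right-above : ∀ {c} u → fun f root ≡ inj₂ c → fun f root D.<₂ u → Right u
  right-above (inj₁ x) eq lt = ⊥-elim (subst (D._<₂ inj₁ x) eq lt)
  right-above (inj₂ y) eq lt = y , refl

  by-root : ∀ u → fun f root ≡ u →
            ∃₂ λ qs₁ qs₂ → p ∷ qs ≡ qs₁ ++ qs₂ × A ⊕ chain qs₁ ⊑ B × chain qs₂ ⊑ C
  -- Everything else in this summand and in the later ones exceeds the root in value, so all of it
  -- follows the root into `C`.
  by-root (inj₂ c) eq = [] , p ∷ qs , refl ,
    restrictˡ (⊑-trans (⊕-mono ⊑-refl 𝟘-⊑) f) (λ { (inj₁ a) → left a }) ,
    restrictʳ (⊑-trans ⊑-⊕ʳ f) all-right
    where
    all-right : ∀ x → Right (fun f (inj₂ x))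
    all-right (inj₁ (inj₁ x)) = right-above _ eq (mono₂ f root (inj₂ (inj₁ (inj₁ x))) tt)
    all-right (inj₁ (inj₂ _)) = c , eq
    all-right (inj₂ x)        = right-above _ eq (mono₂ f root (inj₂ (inj₂ x)) tt)
  -- Whatever precedes the root in position also lies in `B`, so the summand joins `A`, which
  -- gathers those already known to lie on the left.
  by-root (inj₁ b) eq =
    let qs₁ , qs₂ , qs≡ , g , h = ⊕-split-from {A ⊕ ⟦ p ⟧ ⋆} qs (⊑-trans (proj₁ ⊕-assoc) f) all-left
    in p ∷ qs₁ , qs₂ , cong (p ∷_) qs≡ , ⊑-trans (proj₂ ⊕-assoc) g , h
    where
    all-left : ∀ x → Left (fun f (Sum.assocʳ (inj₁ x)))
    all-left (inj₁ a)        = left a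
    all-left (inj₂ (inj₁ x)) = left-before _ eq (mono₁ f (inj₂ (inj₁ (inj₁ x))) root tt)
    all-left (inj₂ (inj₂ _)) = b , eq

⊕-split : ∀ {B C} qs → chain qs ⊑ B ⊕ C →
          ∃₂ λ qs₁ qs₂ → qs ≡ qs₁ ++ qs₂ × chain qs₁ ⊑ B × chain qs₂ ⊑ C
⊕-split qs f =
  let qs₁ , qs₂ , qs≡ , g , h = ⊕-split-from {𝟘} qs (⊑-trans 𝟘⊕ f) (λ ())
  in qs₁ , qs₂ , qs≡ , ⊑-trans ⊑-⊕ʳ g , h
  where
  𝟘⊕ : ∀ {A} → 𝟘 ⊕ A ⊑ A
  𝟘⊕ {A} = record
    { fun   = λ { (inj₂ x) → x }
    ; mono₁ = λ { (inj₂ _) (inj₂ _) → id }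
    ; mono₂ = λ { (inj₂ _) (inj₂ _) → id }
    ; refl₂ = λ { (inj₂ _) (inj₂ _) → id }
    }

-- An element that precedes another one, or exceeds another one in value, cannot map to the extra
-- letter of `B ⋆`. With at least two summands this covers every element; with one, all but its
-- root.
⋆-split : ∀ {B} p qs → chain (p ∷ qs) ⊑ B ⋆ → chain (p ∷ qs) ⊑ B ⊎ (qs ≡ [] × ⟦ p ⟧ ⊑ B)
⋆-split {B} p qs f = by-rest qs f
  where
  module D = Biorder (B ⋆)
  left-before : ∀ u {v} → u D.<₁ v → Left u
  left-before (inj₁ x) _ = x , refl
  left-above : ∀ {u} v → u D.<₂ v → Left v
  left-above         (inj₁ y) _ = y , refl
  left-above {inj₁ x} (inj₂ _) ()
  left-above {inj₂ x} (inj₂ _) ()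

  by-rest : ∀ qs (f : chain (p ∷ qs) ⊑ B ⋆) → chain (p ∷ qs) ⊑ B ⊎ (qs ≡ [] × ⟦ p ⟧ ⊑ B)
  by-rest [] f = by-root (fun f (inj₁ (inj₂ tt))) refl
    where
    left : ∀ x → Left (fun f (inj₁ (inj₁ x)))
    left x = left-before _ (mono₁ f (inj₁ (inj₁ x)) (inj₁ (inj₂ tt)) tt)
    by-root : ∀ u → fun f (inj₁ (inj₂ tt)) ≡ u → chain (p ∷ []) ⊑ B ⊎ ([] ≡ [] × ⟦ p ⟧ ⊑ B)
    by-root (inj₁ b) eq = inj₁ (restrict⋆ f λ { (inj₁ (inj₁ x)) → left x ; (inj₁ (inj₂ _)) → b , eq })
    by-root (inj₂ _) eq = inj₂ (refl , restrict⋆ (⊑-trans ⊑-⋆ (⊑-trans ⊑-⊕ˡ f)) left)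
  by-rest (q ∷ qs) f = inj₁ (restrict⋆ f left)
    where
    left : ∀ x → Left (fun f x)
    left (inj₁ x) = left-before _ (mono₁ f (inj₁ x) (inj₂ (inj₁ (inj₂ tt))) tt)
    left (inj₂ y) = left-above {fun f (inj₁ (inj₂ tt))} _ (mono₂ f (inj₁ (inj₂ tt)) (inj₂ y) tt)

-- Greedy matching of chains in trees

chain-++ : ∀ ps {qs} → chain (ps ++ qs) ⊑ chain ps ⊕ chain qs
chain-++ []       = ⊑-⊕ʳ
chain-++ (p ∷ ps) = ⊑-trans (⊕-mono ⊑-refl (chain-++ ps)) (proj₂ ⊕-assoc)

chain-drop : ∀ n ps → chain (drop n ps) ⊑ chain ps
chain-drop zero    ps       = ⊑-refl
chain-drop (suc n) []       = ⊑-refl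
chain-drop (suc n) (p ∷ ps) = ⊑-trans (chain-drop n ps) ⊑-⊕ʳ

drop-++-≤ : ∀ {A : Set} n (xs : List A) {ys} → n ≤ length xs → drop n (xs ++ ys) ≡ drop n xs ++ ys
drop-++-≤ zero    xs       _         = refl
drop-++-≤ (suc n) (x ∷ xs) (s≤s n≤) = drop-++-≤ n xs n≤

drop-length-++ : ∀ {A : Set} (xs ys : List A) → drop (length xs) (xs ++ ys) ≡ ys
drop-length-++ xs ys = trans (drop-++-≤ (length xs) xs ℕ.≤-refl)
                             (cong (_++ ys) (List.drop-all (length xs) xs ℕ.≤-refl))

take-+ : ∀ {A : Set} m n (xs : List A) → take (m + n) xs ≡ take m xs ++ take n (drop m xs)
take-+ zero    n xs       = refl
take-+ (suc m) zero []    = refl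
take-+ (suc m) (suc n) [] = refl
take-+ (suc m) n (x ∷ xs) = cong (x ∷_) (take-+ m n xs)

-- depth ps t and depth⋆ ps t are the greatest j such that chain (take j ps) embeds into
-- shape t and (shape t) ⋆, respectively.  As every summand ⟦ p ⟧ ⋆ is indecomposable, in a
-- direct sum it can be found greedily.
depth depth⋆ : List 𝔖 → Tree → ℕ
depth ps leaf       = 0
depth ps (node l r) = depth⋆ ps l + depth (drop (depth⋆ ps l) ps) r
depth⋆ []       t = 0
-- A lone summand may use the extra letter of `⋆` as its root, so an occurrence of `p` suffices for
-- it; by `⋆-split` any longer run embeds into `shape t` itself.
depth⋆ (p ∷ ps) t = if does (occurs? p t) then 1 ⊔ depth (p ∷ ps) t else 0

depth⋆-yes : ∀ p ps t → ⟦ p ⟧ ⊑ shape t → depth⋆ (p ∷ ps) t ≡ 1 ⊔ depth (p ∷ ps) t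
depth⋆-yes p ps t p⊑t rewrite dec-true (occurs? p t) p⊑t = refl

depth-sound : ∀ ps t → depth ps t ≤ length ps × chain (take (depth ps t) ps) ⊑ shape t
depth⋆-sound : ∀ ps t → depth⋆ ps t ≤ length ps × chain (take (depth⋆ ps t) ps) ⊑ shape t ⋆

depth-sound ps leaf = z≤n , 𝟘-⊑
depth-sound ps (node l r) with a≤ , f ← depth⋆-sound ps l
                          with b≤ , g ← depth-sound (drop (depth⋆ ps l) ps) r =
  ℕ.≤-trans (ℕ.+-monoʳ-≤ a (subst (b ≤_) (List.length-drop a ps) b≤)) (ℕ.≤-reflexive (ℕ.m+[n∸m]≡n a≤)) ,
  subst (λ qs → chain qs ⊑ shape (node l r)) (sym (take-+ a b ps))
    (⊑-trans (chain-++ (take a ps)) (⊕-mono f g))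
  where
  a = depth⋆ ps l
  b = depth (drop a ps) r
depth⋆-sound []       t = z≤n , 𝟘-⊑
depth⋆-sound (p ∷ ps) t with occurs? p t
... | no _    = z≤n , 𝟘-⊑
... | yes p⊑t with depth (p ∷ ps) t | depth-sound (p ∷ ps) t
...   | zero  | _      = s≤s z≤n , ⊑-trans (⊕-mono (⋆-mono p⊑t) ⊑-refl) ⊕𝟘
  where
  ⊕𝟘 : ∀ {A} → A ⊕ 𝟘 ⊑ A
  ⊕𝟘 {A} = record
    { fun   = λ { (inj₁ x) → x }
    ; mono₁ = λ { (inj₁ _) (inj₁ _) → id }
    ; mono₂ = λ { (inj₁ _) (inj₁ _) → id }
    ; refl₂ = λ { (inj₁ _) (inj₁ _) → id }
    }
...   | suc d | d≤ , f = d≤ , ⊑-trans f ⊑-⋆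

-- Greed is optimal: if `qs₁` embeds on the left, the greedy count `a` is at least its length, so
-- what remains of `qs` is a suffix of `qs₂` and embeds on the right. The tail `rs` is carried along
-- because the left part `qs₁` is measured against the depth for the whole list.
depth-complete : ∀ qs rs t → chain qs ⊑ shape t → length qs ≤ depth (qs ++ rs) t
depth⋆-complete : ∀ qs rs t → chain qs ⊑ shape t ⋆ → length qs ≤ depth⋆ (qs ++ rs) t

depth-complete []       rs leaf f = z≤n
depth-complete (q ∷ qs) rs leaf f = ⊥-elim (fun f (inj₁ (inj₂ tt)))
depth-complete qs rs (node l r) f with ⊕-split qs f
... | qs₁ , qs₂ , refl , g , h = by-cases (ℕ.≤-total (length qs) a)
  where
  a = depth⋆ (qs ++ rs) l
  len₁≤a : length qs₁ ≤ a
  len₁≤a = subst (λ ps → length qs₁ ≤ depth⋆ ps l) (sym (List.++-assoc qs₁ qs₂ rs))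
             (depth⋆-complete qs₁ (qs₂ ++ rs) l g)
  drop≡ : drop a qs ≡ drop (a ∸ length qs₁) qs₂
  drop≡ = trans (cong (λ n → drop n qs) (sym (ℕ.m+[n∸m]≡n len₁≤a)))
          (trans (sym (List.drop-drop (length qs₁) (a ∸ length qs₁) qs))
                 (cong (drop (a ∸ length qs₁)) (drop-length-++ qs₁ qs₂)))
  by-cases : length qs ≤ a ⊎ a ≤ length qs → length qs ≤ depth (qs ++ rs) (node l r)
  by-cases (inj₁ len≤a) = ℕ.≤-trans len≤a (ℕ.m≤m+n a _)
  by-cases (inj₂ a≤len) = begin
    length qs                         ≡⟨ ℕ.m+[n∸m]≡n a≤len ⟨
    a + (length qs ∸ a)               ≡⟨ cong (a +_) (List.length-drop a qs) ⟨
    a + length (drop a qs)            ≤⟨ ℕ.+-monoʳ-≤ a (depth-complete (drop a qs) rs r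
                                           (subst (λ ps → chain ps ⊑ shape r) (sym drop≡)
                                             (⊑-trans (chain-drop (a ∸ length qs₁) qs₂) h))) ⟩
    a + depth (drop a qs ++ rs) r     ≡⟨ cong (λ ps → a + depth ps r) (drop-++-≤ a qs a≤len) ⟨
    a + depth (drop a (qs ++ rs)) r   ∎
    where open ℕ.≤-Reasoning
depth⋆-complete []       rs t f = z≤n
depth⋆-complete (p ∷ qs) rs t f with ⋆-split p qs f
... | inj₂ (refl , p⊑t) rewrite depth⋆-yes p rs t p⊑t = ℕ.m≤m⊔n 1 (depth (p ∷ rs) t)
... | inj₁ g rewrite depth⋆-yes p (qs ++ rs) t (⊑-trans ⊑-⋆ (⊑-trans ⊑-⊕ˡ g)) =
  ℕ.≤-trans (depth-complete (p ∷ qs) rs t g) (ℕ.m≤n⊔m 1 (depth (p ∷ qs ++ rs) t))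

depth≡0 : ∀ p ps t → ¬ ⟦ p ⟧ ⊑ shape t → depth (p ∷ ps) t ≡ 0
depth≡0 p ps t p⋢t with depth (p ∷ ps) t | depth-sound (p ∷ ps) t
... | zero  | _     = refl
... | suc d | _ , f = contradiction (⊑-trans ⊑-⋆ (⊑-trans ⊑-⊕ˡ f)) p⋢t

chain⊑⇒≤depth : ∀ ps t → chain ps ⊑ shape t → length ps ≤ depth ps t
chain⊑⇒≤depth ps t f =
  subst (λ qs → length ps ≤ depth qs t) (List.++-identityʳ ps) (depth-complete ps [] t f)

≤depth⇒chain⊑ : ∀ ps t → length ps ≤ depth ps t → chain ps ⊑ shape t
≤depth⇒chain⊑ ps t len≤ =
  subst (λ qs → chain qs ⊑ shape t) (List.take-all (depth ps t) ps len≤) (proj₂ (depth-sound ps t))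

-- From coefficients to arbitrary weights

q^-refl : ∀ x → (q^ x) x ≡ 1
q^-refl x = cong (λ b → if b then 1 else 0) (dec-true (x ℕ.≟ x) refl)

q^-≢ : ∀ {x d} → x ≢ d → (q^ x) d ≡ 0
q^-≢ {x} {d} x≢d = cong (λ b → if b then 1 else 0) (dec-false (x ℕ.≟ d) x≢d)

-- Coefficients are multiplicities: the head of `xs` has a positive one in `ys`, hence can be
-- removed from both lists.
∑-count : ∀ (f : ℕ → ℕ) xs ys → (∀ d → ∑ xs (λ x → (q^ x) d) ≡ ∑ ys (λ y → (q^ y) d)) →
          ∑ xs f ≡ ∑ ys f
∑-count f []       []       eq = refl
∑-count f []       (y ∷ ys) eq with () ← trans (eq y) (cong (_+ ∑ ys (λ z → (q^ z) y)) (q^-refl y))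
∑-count f (x ∷ xs) ys       eq =
  through (∈-∃++ (x∈ ys (trans (sym (eq x)) (cong (_+ ∑ xs (λ z → (q^ z) x)) (q^-refl x)))))
  where
  x∈ : ∀ ys {n} → ∑ ys (λ y → (q^ y) x) ≡ suc n → x ∈ ys
  x∈ (y ∷ ys) eq with y ℕ.≟ x
  ... | yes refl = here refl
  ... | no y≢x   = there (x∈ ys (trans (cong (_+ ∑ ys (λ z → (q^ z) x)) (sym (q^-≢ y≢x))) eq))
  ∑-middle : ∀ (g : ℕ → ℕ) us {vs} → ∑ (us ++ x ∷ vs) g ≡ g x + ∑ (us ++ vs) g
  ∑-middle g us {vs} = sum-↭ (↭.map⁺ g (↭.shift x us vs))
  through : (∃₂ λ us vs → ys ≡ us ++ x ∷ vs) → f x + ∑ xs f ≡ ∑ ys f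
  through (us , vs , refl) = sym (trans (∑-middle f us) (cong (f x +_) (sym (∑-count f xs (us ++ vs)
    λ d → ℕ.+-cancelˡ-≡ ((q^ x) d) _ _ (trans (eq d) (∑-middle (λ y → (q^ y) d) us))))))

-- Enumeration of trees by size

splits : ℕ → List (ℕ × ℕ)
splits zero    = (0 , 0) ∷ []
splits (suc n) = (0 , suc n) ∷ map (map₁ suc) (splits n)

splits-sound : ∀ n {a b} → (a , b) ∈ splits n → a + b ≡ n
splits-sound zero    (here refl) = refl
splits-sound (suc n) (here refl) = refl
splits-sound (suc n) (there ab∈) with ∈-map⁻ (map₁ suc) ab∈
... | _ , ab∈′ , refl = cong suc (splits-sound n ab∈′)

splits-complete : ∀ a b → (a , b) ∈ splits (a + b)
splits-complete zero    zero    = here refl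
splits-complete zero    (suc b) = here refl
splits-complete (suc a) b       = there (∈-map⁺ (map₁ suc) (splits-complete a b))

splits-unique : ∀ n → AllPairs (λ s t → proj₁ s ≢ proj₁ t) (splits n)
splits-unique zero    = [] ∷ []
splits-unique (suc n) = All.map⁺ (All.tabulate λ _ ()) ∷
  AllPairs.map⁺ (AllPairs.map (λ a≢ → a≢ ∘ ℕ.suc-injective) (splits-unique n))

-- The binary trees with n nodes; k bounds the recursion and has to be at least n.
trees : ℕ → ℕ → List Tree
nodes : ℕ → ℕ × ℕ → List Tree

trees k       zero    = leaf ∷ []
trees zero    (suc n) = []
trees (suc k) (suc n) = concatMap (nodes k) (splits n)
nodes k (a , b) = cartesianProductWith node (trees k a) (trees k b)

∈-nodes⁻ : ∀ k a b {t} → t ∈ nodes k (a , b) → ∃₂ λ l r → l ∈ trees k a × r ∈ trees k b × t ≡ node l r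
∈-nodes⁻ k a b = ∈-cartesianProductWith⁻ node (trees k a) (trees k b)

trees-size : ∀ k n {t} → t ∈ trees k n → size t ≡ n
trees-size k       zero    (here refl) = refl
trees-size (suc k) (suc n) t∈
  with (a , b) , ab∈ , t∈′ ← find (∈-concatMap⁻ (nodes k) {splits n} t∈)
  with l , r , l∈ , r∈ , refl ← ∈-nodes⁻ k a b t∈′ =
  cong suc (trans (cong₂ _+_ (trees-size k a l∈) (trees-size k b r∈)) (splits-sound n ab∈))

trees-complete : ∀ k t → size t ≤ k → t ∈ trees k (size t)
trees-complete k       leaf       _        = here refl
trees-complete (suc k) (node l r) (s≤s n≤k) = ∈-concatMap⁺ (nodes k) {splits (size l + size r)}
  (lose (splits-complete (size l) (size r))
    (∈-cartesianProductWith⁺ node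
      (trees-complete k l (ℕ.≤-trans (ℕ.m≤m+n _ _) n≤k))
      (trees-complete k r (ℕ.≤-trans (ℕ.m≤n+m _ _) n≤k))))

-- Trees from different splits differ in the size of their left subtree.
trees-unique : ∀ k n → Unique (trees k n)
trees-unique k       zero    = [] ∷ []
trees-unique zero    (suc n) = []
trees-unique (suc k) (suc n) = AllPairs.concat⁺
  (All.map⁺ (All.tabulate λ {s} _ → Unique.cartesianProductWith⁺ node (λ { refl → refl , refl })
    (trees-unique k (proj₁ s)) (trees-unique k (proj₂ s))))
  (AllPairs.map⁺ (AllPairs.map (λ {s} {s′} → disjoint {s} {s′}) (splits-unique n)))
  where
  disjoint : ∀ {s s′ : ℕ × ℕ} → proj₁ s ≢ proj₁ s′ → All (λ t → All (t ≢_) (nodes k s′)) (nodes k s)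
  disjoint {a , b} {a′ , b′} a≢a′ =
    All.tabulate λ t∈ → All.tabulate λ t∈′ t≡t′ → a≢a′ (same t∈ t∈′ t≡t′)
    where
    same : ∀ {t t′} → t ∈ nodes k (a , b) → t′ ∈ nodes k (a′ , b′) → t ≡ t′ → a ≡ a′
    same t∈ t∈′ refl
      with l , r , l∈ , r∈ , refl ← ∈-nodes⁻ k a b t∈
      with l , r , l∈′ , r∈′ , refl ← ∈-nodes⁻ k a′ b′ t∈′ =
      trans (sym (trees-size k a l∈)) (trees-size k a′ l∈′)

-- Avoiding permutations against avoiding trees

avoiders : ℕ → ℕ → 𝔖 → List Tree
avoiders k n p = filter (λ t → ¬? (occurs? p t)) (trees k n)

permAvoiders : ∀ n → 𝔖 → List (Permutation′ n)
permAvoiders n p = filter (avoidsAll? (p312 ∷ p ∷ [])) (permutations n)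

-- The two enumerations come in unrelated orders, but lists without repetition that have the same
-- members are rearrangements of each other. Comparing words turns `_≈_` of permutations into
-- propositional equality.
codes-↭-words : ∀ {k n} p → n ≤ k → map code (permAvoiders n p) ↭ map (word 0) (avoiders k n p)
codes-↭-words {k} {n} p n≤k = ∼bag⇒↭ (unique∧set⇒bag codes-unique words-unique (mk⇔ to from))
  where
  codes-unique : Unique (map code (permAvoiders n p))
  codes-unique = AllPairs.map⁺ (AllPairs.map
    (λ σ≉τ eq → σ≉τ (Fin.toℕ-injective ∘ tabulate-injective eq))
    (AllPairs.filter⁺ (avoidsAll? (p312 ∷ p ∷ [])) (permutations-unique n)))

  words-unique : Unique (map (word 0) (avoiders k n p))
  words-unique = Unique.map⁺ (word-injective 0 _ _) (Unique.filter⁺ (λ t → ¬? (occurs? p t)) (trees-unique k n))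

  to : ∀ {w} → w ∈ map code (permAvoiders n p) → w ∈ map (word 0) (avoiders k n p)
  to w∈
    with σ , σ∈ , refl ← ∈-map⁻ code w∈
    with _ , (no312 ∷ no-p ∷ []) ← ∈-filter⁻ (avoidsAll? (p312 ∷ p ∷ [])) {xs = permutations n} σ∈
    with t , eq , refl ← code-word σ no312 =
    subst (_∈ map (word 0) (avoiders k n p)) (sym eq) (∈-map⁺ (word 0)
      (∈-filter⁺ (λ t → ¬? (occurs? p t)) (trees-complete k t n≤k)
        (λ p⊑t → no-p (⊑⇒contains σ p (⊑-trans p⊑t (proj₂ (code-shape σ t eq)))))))

  from : ∀ {w} → w ∈ map (word 0) (avoiders k n p) → w ∈ map code (permAvoiders n p)
  from w∈
    with t , t∈ , refl ← ∈-map⁻ (word 0) w∈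
    with t∈′ , no-p ← ∈-filter⁻ (λ t → ¬? (occurs? p t)) {xs = trees k n} t∈
    with refl ← trees-size k n t∈′
    with σ , eq ← word-code t
    -- The list contains `σ` only up to `_≈_`, so its listed representative `τ` takes over.
    with τ , τ∈ , σ≈τ ← find (permutations-complete σ) =
    subst (_∈ map code (permAvoiders n p)) τ-code (∈-map⁺ code
      (∈-filter⁺ (avoidsAll? (p312 ∷ p ∷ [])) τ∈
        ((Avoids312⇒avoids (shape-avoids312 t) ∘ in-t p312) ∷ (no-p ∘ in-t p) ∷ [])))
    where
    τ-code : code τ ≡ word 0 t
    τ-code = trans (List.tabulate-cong (λ i → cong toℕ (sym (σ≈τ i)))) eq
    in-t : ∀ q → Contains τ q → ⟦ q ⟧ ⊑ shape t
    in-t q c = ⊑-trans (contains⇒⊑ τ q c) (proj₁ (code-shape τ t τ-code))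

∑-permAvoiders : ∀ {k n} p → n ≤ k → ∀ (f : ℕ → ℕ) →
                 ∑ (permAvoiders n p) (f ∘ inv) ≡ ∑ (avoiders k n p) (f ∘ invTree)
∑-permAvoiders {k} {n} p n≤k f = begin
  ∑ (permAvoiders n p) (f ∘ inv)
    ≡⟨ ∑-cong (permAvoiders n p) (λ {σ} _ → cong f (inv-code σ)) ⟩
  ∑ (permAvoiders n p) (f ∘ invWord ∘ code)
    ≡⟨ ∑-map (f ∘ invWord) code (permAvoiders n p) ⟨
  ∑ (map code (permAvoiders n p)) (f ∘ invWord)
    ≡⟨ sum-↭ (↭.map⁺ (f ∘ invWord) (codes-↭-words p n≤k)) ⟩
  ∑ (map (word 0) (avoiders k n p)) (f ∘ invWord)
    ≡⟨ ∑-map (f ∘ invWord) (word 0) (avoiders k n p) ⟩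
  ∑ (avoiders k n p) (f ∘ invWord ∘ word 0)
    ≡⟨ ∑-cong (avoiders k n p) (λ {t} _ → cong f (invWord-word 0 t)) ⟩
  ∑ (avoiders k n p) (f ∘ invTree) ∎
  where open ≡-Reasoning

F-∑ : ∀ {k n} p → n ≤ k → ∀ d → F n (p312 ∷ p ∷ []) d ≡ ∑ (avoiders k n p) (λ t → (q^ invTree t) d)
F-∑ {n = n} p n≤k d = trans (coefficient (permAvoiders n p)) (∑-permAvoiders p n≤k (λ a → (q^ a) d))
  where
  coefficient : ∀ σs → foldr _+ₚ_ 0ₚ (map (λ σ → q^ inv σ) σs) d ≡ ∑ σs (λ σ → (q^ inv σ) d)
  coefficient []       = refl
  coefficient (σ ∷ σs) = cong ((q^ inv σ) d +_) (coefficient σs)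

-- Any weight `f` is allowed, not just coefficients: in the induction the inversions of a left
-- subtree enter through a whole sum over the right subtrees.
EquiAvoided : 𝔖 → 𝔖 → Set
EquiAvoided p p′ = ∀ k n → n ≤ k → ∀ (f : ℕ → ℕ) →
                   ∑ (avoiders k n p) (f ∘ invTree) ≡ ∑ (avoiders k n p′) (f ∘ invTree)

wilf⇒equiAvoided : ∀ p p′ → InvWilfEquivalent (p312 ∷ p ∷ []) (p312 ∷ p′ ∷ []) → EquiAvoided p p′
wilf⇒equiAvoided p p′ equiv k n n≤k f = begin
  ∑ (avoiders k n p) (f ∘ invTree)
    ≡⟨ ∑-map f invTree (avoiders k n p) ⟨
  ∑ (map invTree (avoiders k n p)) f
    ≡⟨ ∑-count f (map invTree (avoiders k n p)) (map invTree (avoiders k n p′)) count ⟩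
  ∑ (map invTree (avoiders k n p′)) f
    ≡⟨ ∑-map f invTree (avoiders k n p′) ⟩
  ∑ (avoiders k n p′) (f ∘ invTree) ∎
  where
  open ≡-Reasoning
  multiplicity : ∀ p d → ∑ (map invTree (avoiders k n p)) (λ x → (q^ x) d) ≡ F n (p312 ∷ p ∷ []) d
  multiplicity p d = trans (∑-map (λ x → (q^ x) d) invTree (avoiders k n p)) (sym (F-∑ p n≤k d))
  count : ∀ d → ∑ (map invTree (avoiders k n p)) (λ x → (q^ x) d) ≡
                ∑ (map invTree (avoiders k n p′)) (λ x → (q^ x) d)
  count d = trans (multiplicity p d) (trans (equiv n d) (sym (multiplicity p′ d)))

-- Joint equidistribution of depth and inversions

EquiDepth : ℕ → ℕ → (Tree → ℕ) → (Tree → ℕ) → Set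
EquiDepth k n h h′ = ∀ (φ : ℕ → ℕ → ℕ) →
  ∑ (trees k n) (λ t → φ (h t) (invTree t)) ≡ ∑ (trees k n) (λ t → φ (h′ t) (invTree t))

-- Where p does not occur, depth⋆ and depth both vanish, so 1 ⊔ depth is 1.
depth⋆-depth : ∀ k n p ps (φ : ℕ → ℕ → ℕ) →
  ∑ (trees k n) (λ t → φ (depth⋆ (p ∷ ps) t) (invTree t)) + ∑ (avoiders k n p) (φ 1 ∘ invTree) ≡
  ∑ (trees k n) (λ t → φ (1 ⊔ depth (p ∷ ps) t) (invTree t)) + ∑ (avoiders k n p) (φ 0 ∘ invTree)
depth⋆-depth k n p ps φ = begin
  ∑ (trees k n) f⋆ + ∑ (avoiders k n p) (φ 1 ∘ invTree)
    ≡⟨ cong (∑ (trees k n) f⋆ +_) (∑-filter avoids? (φ 1 ∘ invTree) (trees k n)) ⟩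
  ∑ (trees k n) f⋆ + ∑ (trees k n) (corrected 1)
    ≡⟨ ∑-+ f⋆ (corrected 1) (trees k n) ⟨
  ∑ (trees k n) (λ t → f⋆ t + corrected 1 t)
    ≡⟨ ∑-cong (trees k n) (λ {t} _ → pointwise t) ⟩
  ∑ (trees k n) (λ t → f t + corrected 0 t)
    ≡⟨ ∑-+ f (corrected 0) (trees k n) ⟩
  ∑ (trees k n) f + ∑ (trees k n) (corrected 0)
    ≡⟨ cong (∑ (trees k n) f +_) (∑-filter avoids? (φ 0 ∘ invTree) (trees k n)) ⟨
  ∑ (trees k n) f + ∑ (avoiders k n p) (φ 0 ∘ invTree) ∎
  where
  open ≡-Reasoning
  avoids? : ∀ t → Dec (¬ ⟦ p ⟧ ⊑ shape t)
  avoids? t = ¬? (occurs? p t)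
  f⋆ f : Tree → ℕ
  f⋆ t = φ (depth⋆ (p ∷ ps) t) (invTree t)
  f t  = φ (1 ⊔ depth (p ∷ ps) t) (invTree t)
  corrected : ℕ → Tree → ℕ
  corrected i t = if does (avoids? t) then φ i (invTree t) else 0
  pointwise : ∀ t → f⋆ t + corrected 1 t ≡ f t + corrected 0 t
  pointwise t with occurs? p t
  ... | yes p⊑t = refl
  ... | no p⋢t rewrite depth≡0 p ps t p⋢t = ℕ.+-comm (φ 0 (invTree t)) _

depth-equi⇒depth⋆-equi : ∀ {k n ps ps′} → n ≤ k → Pointwise EquiAvoided ps ps′ →
  EquiDepth k n (depth ps) (depth ps′) → EquiDepth k n (depth⋆ ps) (depth⋆ ps′)
depth-equi⇒depth⋆-equi n≤k [] equi φ = refl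
depth-equi⇒depth⋆-equi {k} {n} {p ∷ ps} {p′ ∷ ps′} n≤k (p~p′ ∷ _) equi φ =
  -- The mass to be moved from 1 to 0 is added on both sides in place of a subtraction, and
  -- cancelled at the end.
  ℕ.+-cancelʳ-≡ (∑ (avoiders k n p) (φ 1 ∘ invTree)) _ _ (begin
    ∑ (trees k n) (λ t → φ (depth⋆ (p ∷ ps) t) (invTree t)) + ∑ (avoiders k n p) (φ 1 ∘ invTree)
      ≡⟨ depth⋆-depth k n p ps φ ⟩
    ∑ (trees k n) (λ t → φ (1 ⊔ depth (p ∷ ps) t) (invTree t)) + ∑ (avoiders k n p) (φ 0 ∘ invTree)
      ≡⟨ cong₂ _+_ (equi (φ ∘ (1 ⊔_))) (p~p′ k n n≤k (φ 0)) ⟩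
    ∑ (trees k n) (λ t → φ (1 ⊔ depth (p′ ∷ ps′) t) (invTree t)) + ∑ (avoiders k n p′) (φ 0 ∘ invTree)
      ≡⟨ depth⋆-depth k n p′ ps′ φ ⟨
    ∑ (trees k n) (λ t → φ (depth⋆ (p′ ∷ ps′) t) (invTree t)) + ∑ (avoiders k n p′) (φ 1 ∘ invTree)
      ≡⟨ cong (∑ (trees k n) (λ t → φ (depth⋆ (p′ ∷ ps′) t) (invTree t)) +_) (p~p′ k n n≤k (φ 1)) ⟨
    ∑ (trees k n) (λ t → φ (depth⋆ (p′ ∷ ps′) t) (invTree t)) + ∑ (avoiders k n p) (φ 1 ∘ invTree) ∎)
  where open ≡-Reasoning

drop⁺ : ∀ {R : A → B → Set} m {xs ys} → Pointwise R xs ys → Pointwise R (drop m xs) (drop m ys)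
drop⁺ zero    rs       = rs
drop⁺ (suc m) []       = []
drop⁺ (suc m) (_ ∷ rs) = drop⁺ m rs

-- For fixed sizes of the subtrees, the sum over right subtrees depends on the left one only through
-- its `depth⋆` and `invTree`, so it is an admissible weight there. The left statistic is exchanged
-- first under this weight, then the right one for each left subtree.
depth-equi : ∀ k n {ps ps′} → n ≤ k → Pointwise EquiAvoided ps ps′ → EquiDepth k n (depth ps) (depth ps′)
depth-equi k       zero    n≤k       equi φ = refl
depth-equi (suc k) (suc n) {ps} {ps′} (s≤s n≤k) equi φ = begin
  ∑ (trees (suc k) (suc n)) (weight ps)
    ≡⟨ ∑-concatMap (weight ps) (nodes k) (splits n) ⟩
  ∑ (splits n) (λ s → ∑ (nodes k s) (weight ps))
    ≡⟨ ∑-cong (splits n) (λ {s} s∈ → by-split (proj₁ s) (proj₂ s) (splits-sound n s∈)) ⟩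
  ∑ (splits n) (λ s → ∑ (nodes k s) (weight ps′))
    ≡⟨ ∑-concatMap (weight ps′) (nodes k) (splits n) ⟨
  ∑ (trees (suc k) (suc n)) (weight ps′) ∎
  where
  open ≡-Reasoning
  weight : List 𝔖 → Tree → ℕ
  weight ps t = φ (depth ps t) (invTree t)

  by-split : ∀ a b → a + b ≡ n → ∑ (nodes k (a , b)) (weight ps) ≡ ∑ (nodes k (a , b)) (weight ps′)
  by-split a b refl = begin
    ∑ (nodes k (a , b)) (weight ps)
      ≡⟨ unfold ps ⟩
    ∑ (trees k a) (λ l → right ps (depth⋆ ps l) (invTree l))
      ≡⟨ depth-equi⇒depth⋆-equi a≤k equi (depth-equi k a a≤k equi) (right ps) ⟩
    ∑ (trees k a) (λ l → right ps (depth⋆ ps′ l) (invTree l))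
      ≡⟨ ∑-cong (trees k a) (λ {l} _ → right-equi (depth⋆ ps′ l) (invTree l)) ⟩
    ∑ (trees k a) (λ l → right ps′ (depth⋆ ps′ l) (invTree l))
      ≡⟨ unfold ps′ ⟨
    ∑ (nodes k (a , b)) (weight ps′) ∎
    where
    a≤k = ℕ.≤-trans (ℕ.m≤m+n a b) n≤k
    b≤k = ℕ.≤-trans (ℕ.m≤n+m b a) n≤k
    -- The sum over right subtrees for a left one with `depth⋆` equal to `i` and with `x`
    -- inversions; the summand `a` is the size of that left subtree.
    right : List 𝔖 → ℕ → ℕ → ℕ
    right ps i x = ∑ (trees k b) (λ r → φ (i + depth (drop i ps) r) (x + a + invTree r))
    unfold : ∀ ps → ∑ (nodes k (a , b)) (weight ps) ≡ ∑ (trees k a) (λ l → right ps (depth⋆ ps l) (invTree l))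
    unfold ps = trans (∑-product (weight ps) node (trees k a) (trees k b))
      (∑-cong (trees k a) λ {l} l∈ → ∑-cong (trees k b) λ {r} _ →
        cong (λ m → φ (depth ps (node l r)) (invTree l + m + invTree r)) (trees-size k a l∈))
    right-equi : ∀ i x → right ps i x ≡ right ps′ i x
    right-equi i x = depth-equi k b b≤k (drop⁺ i equi) (λ j y → φ (i + j) (x + a + y))

F-depth : ∀ {r} (π : Fin r → 𝔖) n d →
          F n (p312 ∷ (ι r [ (λ i → (π i) *) ]) ∷ []) d ≡
          ∑ (trees n n) (λ t → if does (¬? (r ℕ.≤? depth (tabulate π) t)) then (q^ invTree t) d else 0)
F-depth {r} π n d = trans (F-∑ {n} {n} p ℕ.≤-refl d)
  (trans (∑-filter (λ t → ¬? (occurs? p t)) (λ t → (q^ invTree t) d) (trees n n))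
    (∑-cong (trees n n) λ {t} _ → cong (λ b → if b then (q^ invTree t) d else 0)
      (does-⇔ (mk⇔ (_∘ from t) (_∘ to t)) (¬? (occurs? p t)) (¬? (r ℕ.≤? depth (tabulate π) t)))))
  where
  p : 𝔖
  p = ι r [ (λ i → (π i) *) ]
  to : ∀ t → ⟦ p ⟧ ⊑ shape t → r ≤ depth (tabulate π) t
  to t p⊑t = subst (_≤ depth (tabulate π) t) (List.length-tabulate π)
    (chain⊑⇒≤depth (tabulate π) t (⊑-trans (proj₂ (ι-inflation-≋ π)) p⊑t))
  from : ∀ t → r ≤ depth (tabulate π) t → ⟦ p ⟧ ⊑ shape t
  from t r≤ = ⊑-trans (proj₁ (ι-inflation-≋ π))
    (≤depth⇒chain⊑ (tabulate π) t (subst (_≤ depth (tabulate π) t) (sym (List.length-tabulate π)) r≤))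

proposition1p2 : (r : ℕ) (π π′ : Fin r → 𝔖) →
    (∀ i → InvWilfEquivalent (p312 ∷ π i ∷ []) (p312 ∷ π′ i ∷ [])) →
    InvWilfEquivalent (p312 ∷ (ι r [ (λ i → (π i) *) ]) ∷ [])
    (p312 ∷ (ι r [ (λ i → (π′ i) *) ]) ∷ [])
proposition1p2 r π π′ equiv n d = begin
  F n (p312 ∷ (ι r [ (λ i → (π i) *) ]) ∷ []) d
    ≡⟨ F-depth π n d ⟩
  ∑ (trees n n) (λ t → φ (depth (tabulate π) t) (invTree t))
    ≡⟨ depth-equi n n ℕ.≤-refl (Pointwise.tabulate⁺ (λ i → wilf⇒equiAvoided (π i) (π′ i) (equiv i))) φ ⟩
  ∑ (trees n n) (λ t → φ (depth (tabulate π′) t) (invTree t))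
    ≡⟨ F-depth π′ n d ⟨
  F n (p312 ∷ (ι r [ (λ i → (π′ i) *) ]) ∷ []) d ∎
  where
  open ≡-Reasoning
  -- The whole pattern has `r` summands, so depth below `r` means avoidance; the weight then
  -- extracts the coefficient at `d`.
  φ : ℕ → ℕ → ℕ
  φ h x = if does (¬? (r ℕ.≤? h)) then (q^ x) d else 0
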